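{- Let $m\equiv 2 \pmod 4$, let $\mathbb M=\mathbb F_{2^m}$ and let $\mathbb K=\mathbb F_{2^{m/2}}\subset\mathbb M$, with $Q=2^{m/2}$. Let $1\le k\le m-1$ with $\gcd(k,m)=1$, and put $q=2^k$, $r=qQ=2^{k+m/2}$. Let $B\in\mathbb M^\times$ be a non-cube (i.e. $B\in\mathbb M^\times\setminus(\mathbb M^\times)^3$) and let $a\in\mathbb K^\times$ be such that $B^{q+r}\neq a^{q+1}$. Define $F:\mathbb M\times\mathbb M\to\mathbb M\times\mathbb M$ by $$F(x,y)=\left(x^{q+1}+By^{q+1},\; x^{r}y+\frac{a}{B}\,xy^{r}\right).$$ Then $F$ is APN.
   Context: A function $F$ from a finite-dimensional $\mathbb F_2$-vector space $V$ to itself is almost perfect nonlinear (APN) if for every nonzero $c\in V$ and every $d\in V$ the equation $F(z)+F(z+c)=d$ has zero or two solutions $z\in V$. Here $V=\mathbb M\times\mathbb M$. -}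

module Defs where

open import Level using (Level; _⊔_) renaming (suc to lsuc)
open import Algebra.Bundles using (AbelianGroup; CommutativeRing)
open import Algebra.Construct.DirectProduct using () renaming (abelianGroup to _×ᴬ_)
open import Algebra.Definitions using (Invertible)
open import Algebra.Morphism.Structures using (IsRingMonomorphism)
open import Data.Fin.Base using (Fin)
open import Data.Nat.Base as ℕ using (ℕ)
open import Data.Product.Base using (Σ; ∃-syntax; _×_; _,_; proj₁)
open import Data.Sum.Base using (_⊎_)
open import Function.Bundles using (Func; Inverse)
open import Relation.Binary.Bundles using (Setoid)
import Relation.Binary.Construct.On as On
open import Relation.Binary.PropositionalEquality using (setoid)
open import Relation.Nullary.Negation using (¬_)
import Algebra.Properties.Semiring.Exp as Exp

private
  variable
    c c′ ℓ ℓ′ : Level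

HasCardinality : Setoid c ℓ → ℕ → Set (c ⊔ ℓ)
HasCardinality S n = Inverse S (setoid (Fin n))

record Field (c ℓ : Level) : Set (lsuc (c ⊔ ℓ)) where
  field
    commutativeRing : CommutativeRing c ℓ

  open CommutativeRing commutativeRing public

  infix 4 _≉0

  _≉0 : Carrier → Set ℓ
  x ≉0 = ¬ (x ≈ 0#)

  field
    1≉0        : 1# ≉0
    invertible : ∀ {x} → x ≉0 → Invertible _≈_ 1# _*_ x

  open Exp semiring public using (_^_; ^-congˡ)

  _/_⟨_⟩ : Carrier → (y : Carrier) → y ≉0 → Carrier
  x / _ ⟨ y≉0 ⟩ = x * proj₁ (invertible y≉0)

  NonCube : Carrier → Set (c ⊔ ℓ)
  NonCube x = ¬ (∃[ y ] y ≉0 × y ^ 3 ≈ x)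

-- A finite field of order n is determined up to isomorphism by n, so 𝔽ₙ is
-- rendered as an arbitrary field with exactly n elements.
IsFiniteFieldOfOrder : ℕ → Field c ℓ → Set (c ⊔ ℓ)
IsFiniteFieldOfOrder n K = HasCardinality (Field.setoid K) n

IsEmbedding : (K : Field c ℓ) (M : Field c′ ℓ′) →
              (Field.Carrier K → Field.Carrier M) → Set (c ⊔ ℓ ⊔ ℓ′)
IsEmbedding K M = IsRingMonomorphism
  (CommutativeRing.rawRing (Field.commutativeRing K))
  (CommutativeRing.rawRing (Field.commutativeRing M))

-- An 𝔽₂-vector space enters the definition of almost perfect nonlinearity only
-- through its additive group.
module _ (V : AbelianGroup c ℓ) where
  open AbelianGroup V renaming (Carrier to ∣V∣; setoid to Vˢ; _∙_ to _+_; ε to 0#)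

  Solutions : Func Vˢ Vˢ → ∣V∣ → ∣V∣ → Setoid (c ⊔ ℓ) ℓ
  Solutions F a d = On.setoid {B = Σ ∣V∣ λ z → (to z + to (z + a)) ≈ d} Vˢ proj₁
    where open Func F using (to)

  APN : Func Vˢ Vˢ → Set (c ⊔ ℓ)
  APN F = ∀ a → ¬ (a ≈ 0#) → ∀ d →
    HasCardinality (Solutions F a d) 0 ⊎ HasCardinality (Solutions F a d) 2

module _ (M : Field c ℓ) where
  open Field M

  _² : AbelianGroup c ℓ
  _² = +-abelianGroup ×ᴬ +-abelianGroup

  biprojective : (q r : ℕ) (B : Carrier) → B ≉0 → (a : Carrier) →
                 Func (AbelianGroup.setoid _²) (AbelianGroup.setoid _²)
  biprojective q r B B≉0 a = record
    { to   = λ (x , y) →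
        ( x ^ (q ℕ.+ 1) + B * y ^ (q ℕ.+ 1)
        , x ^ r * y + (a / B ⟨ B≉0 ⟩) * (x * y ^ r) )
    ; cong = λ (x≈x′ , y≈y′) →
        ( +-cong (^-congˡ (q ℕ.+ 1) x≈x′) (*-congˡ (^-congˡ (q ℕ.+ 1) y≈y′))
        , +-cong (*-cong (^-congˡ r x≈x′) y≈y′)
                 (*-congˡ (*-cong x≈x′ (^-congˡ r y≈y′))) )
    }

{-# OPTIONS --safe #-}

-- F is quadratic, so it is APN if for (u, v) ≠ 0 the linearised system in (x, y) has only the
-- solutions 0 and (u, v). Here q ≡ Q ≡ 2 and r ≡ 1 modulo 3, so that x^q ≡ x̄ ≡ x² modulo cubes
-- (x̄ = x^Q), and elements of 𝕂^× are cubes. If u or v vanishes, a nontrivial solution would make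
-- B a cube. Otherwise put x = s u, y = t v, v = w u, b = B w^(q+1) and A = a w^(q+r) ∈ 𝕂; the
-- system becomes
--   s^q + s = b (t^q + t),   b (s^r + t) = A (s + t^r).
-- With p = s + t̄ and δ = b b̄ + A ∈ 𝕂, combining these with their conjugates gives
--   δ (t^q + t) = A p̄ + b̄ p,   δ p^q = b (A + 1) p̄.
-- If δ ≠ 0, then p ≠ 0 would make b a cube; so p = 0, then t^q = t and s = t̄ = t ∈ 𝔽₂. If δ = 0,
-- then B^(q+r) ≠ a^(q+1) amounts to A ≠ 1, which again forces p = 0 and t^q = t.
module Submission where

open import Defs
open import Algebra.Bundles using (AbelianGroup; CommutativeMonoid; CommutativeRing)
open import Algebra.Morphism.Structures using (IsRingMonomorphism)
open import Algebra.Solver.Ring.AlmostCommutativeRing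
  using (fromCommutativeRing; Induced-equivalence; _-Raw-AlmostCommutative⟶_)
open import Data.Bool.Base using (Bool; true; false)
open import Data.Bool.Properties using (xor-∧-commutativeRing)
open import Data.Empty using (⊥; ⊥-elim)
open import Data.Fin.Base using (Fin; zero; suc; punchIn)
open import Data.Fin.Properties as Fin using (punchInᵢ≢i; any?; *↔×)
open import Data.Maybe.Base using (just; nothing)
open import Data.Nat.Base as ℕ using (ℕ; zero; suc)
open import Data.Nat.DivMod using (m≡m%n+[m/n]*n; m%n<n; m*n/n≡m)
open import Data.Nat.Divisibility using (_∣_; divides; ∣1⇒≡1)
open import Data.Nat.GCD using (gcd; GCD; gcd-GCD; gcd-greatest; module Bézout)
import Data.Nat.Properties as ℕₚ
open import Data.Nat.Tactic.RingSolver using (solve-∀)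
open import Data.Product.Base using (∃; ∃-syntax; _×_; _,_; proj₁; proj₂)
open import Data.Product.Function.NonDependent.Setoid using (_×-inverse_)
open import Data.Product.Relation.Binary.Pointwise.NonDependent using (_×ₛ_; Pointwise-≡↔≡)
open import Data.Sum.Base as Sum using (_⊎_; inj₁; inj₂)
open import Function.Base using (_∘_; _$_)
open import Function.Bundles using (Func; Inverse)
import Function.Construct.Composition as Composition
import Function.Construct.Symmetry as Symmetry
open import Level using (Level; _⊔_)
open import Relation.Binary.Bundles using (Setoid)
open import Relation.Binary.Definitions using (Decidable; WeaklyDecidable)
open import Relation.Binary.PropositionalEquality as ≡ using (_≡_)
open import Relation.Nullary.Decidable using (Dec; yes; no; map′)
open import Relation.Nullary.Negation using (¬_; contradiction)
import Algebra.Properties.CommutativeMonoid.Sum as FiniteSum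
import Algebra.Properties.CommutativeSemiring.Exp as Exp
import Algebra.Properties.Group as GroupProperties
import Algebra.Properties.Monoid.Mult as Mult
import Algebra.Properties.Ring as RingProperties
import Algebra.Properties.Semiring.Mult as SemiringMult
import Algebra.Solver.CommutativeMonoid as CommutativeMonoidSolver
import Algebra.Solver.Ring as RingSolver
import Relation.Binary.Reasoning.Setoid as SetoidReasoning

private
  variable
    c ℓ c′ ℓ′ : Level

-- Finite setoids: decidability, search and reindexing of sums.

×-hasCardinality : {S : Setoid c ℓ} {T : Setoid c′ ℓ′} {m n : ℕ} →
  HasCardinality S m → HasCardinality T n → HasCardinality (S ×ₛ T) (m ℕ.* n)
×-hasCardinality S≅m T≅n =
  Composition.inverse (S≅m ×-inverse T≅n)
    (Composition.inverse Pointwise-≡↔≡ (Symmetry.inverse *↔×))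

module FiniteSetoid {S : Setoid c ℓ} {n : ℕ} (S≅n : HasCardinality S n) where
  open Setoid S
  open Inverse S≅n

  element : Fin n → Carrier
  element = from

  element-index : ∀ x → element (to x) ≈ x
  element-index = strictlyInverseʳ

  _≟_ : Decidable _≈_
  x ≟ y = map′ (λ i≡j → trans (sym (element-index x)) (trans (from-cong i≡j) (element-index y)))
               to-cong (to x Fin.≟ to y)

  search : ∀ {p} {P : Carrier → Set p} → (∀ {x y} → x ≈ y → P x → P y) →
           (∀ x → Dec (P x)) → Dec (∃ P)
  search resp P? = map′ (λ (i , p) → element i , p)
                        (λ (x , p) → to x , resp (sym (element-index x)) p)
                        (any? (P? ∘ element))

  module _ (G : CommutativeMonoid c′ ℓ′) where
    private module G = CommutativeMonoid G
    open FiniteSum G using (sum; sum-permute; sum-cong-≋)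

    -- Conjugated by the enumeration, `π` becomes a permutation of `Fin n`. Used additively for a
    -- translation and multiplicatively for a homothety.
    sum-reindex : (π : Inverse S S) (f : Carrier → G.Carrier) →
                  (∀ {x y} → x ≈ y → f x G.≈ f y) →
                  sum (f ∘ element) G.≈ sum (f ∘ Inverse.to π ∘ element)
    sum-reindex π f f-cong = G.trans
      (sum-permute (f ∘ element)
        (Composition.inverse (Symmetry.inverse S≅n) (Composition.inverse π S≅n)))
      (sum-cong-≋ λ i → f-cong (element-index (Inverse.to π (element i))))

-- Arithmetic in a field, and its cubes.

module FieldProperties (M : Field c ℓ) where
  open Field M hiding (zero)
  open SetoidReasoning setoid
  open Exp commutativeSemiring public
    using (^-congʳ; ^-homo-*; ^-assocʳ; ^-distrib-*)

  infixl 8 _⁻¹⟨_⟩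
  _⁻¹⟨_⟩ : (x : Carrier) → x ≉0 → Carrier
  x ⁻¹⟨ x≉0 ⟩ = proj₁ (invertible x≉0)

  *-cancelˡ : ∀ {x} → x ≉0 → ∀ {y z} → x * y ≈ x * z → y ≈ z
  *-cancelˡ {x} x≉0 {y} {z} xy≈xz = begin
    y              ≈⟨ *-identityˡ y ⟨
    1# * y         ≈⟨ *-congʳ x⁻¹x≈1 ⟨
    x⁻¹ * x * y    ≈⟨ *-assoc x⁻¹ x y ⟩
    x⁻¹ * (x * y)  ≈⟨ *-congˡ xy≈xz ⟩
    x⁻¹ * (x * z)  ≈⟨ *-assoc x⁻¹ x z ⟨
    x⁻¹ * x * z    ≈⟨ *-congʳ x⁻¹x≈1 ⟩
    1# * z         ≈⟨ *-identityˡ z ⟩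
    z              ∎
    where
    x⁻¹ = x ⁻¹⟨ x≉0 ⟩
    x⁻¹x≈1 = proj₁ (proj₂ (invertible x≉0))

  xy≈0⇒y≈0 : ∀ {x y} → x ≉0 → x * y ≈ 0# → y ≈ 0#
  xy≈0⇒y≈0 {x} x≉0 xy≈0 = *-cancelˡ x≉0 (trans xy≈0 (sym (zeroʳ x)))

  x/y*y≈x : ∀ {x y} (y≉0 : y ≉0) → x / y ⟨ y≉0 ⟩ * y ≈ x
  x/y*y≈x {x} y≉0 = trans (*-assoc x _ _)
    (trans (*-congˡ (proj₁ (proj₂ (invertible y≉0)))) (*-identityʳ x))

  *-≉0 : ∀ {x y} → x ≉0 → y ≉0 → (x * y) ≉0
  *-≉0 x≉0 y≉0 xy≈0 = y≉0 (xy≈0⇒y≈0 x≉0 xy≈0)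

  ^-≉0 : ∀ {x} n → x ≉0 → (x ^ n) ≉0
  ^-≉0 zero    x≉0 = 1≉0
  ^-≉0 (suc n) x≉0 = *-≉0 x≉0 (^-≉0 n x≉0)

  x^[n+1]≈x^n*x : ∀ x n → x ^ (n ℕ.+ 1) ≈ x ^ n * x
  x^[n+1]≈x^n*x x n = trans (^-homo-* x n 1) (*-congˡ (*-identityʳ x))

  1^n≈1 : ∀ n → 1# ^ n ≈ 1#
  1^n≈1 zero    = refl
  1^n≈1 (suc n) = trans (*-identityˡ _) (1^n≈1 n)

  ^-comm : ∀ x m n → (x ^ m) ^ n ≈ (x ^ n) ^ m
  ^-comm x m n = begin
    (x ^ m) ^ n    ≈⟨ ^-assocʳ x m n ⟩
    x ^ (m ℕ.* n)  ≈⟨ ^-congʳ x (ℕₚ.*-comm m n) ⟩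
    x ^ (n ℕ.* m)  ≈⟨ ^-assocʳ x n m ⟨
    (x ^ n) ^ m    ∎


  -- Unlike in `NonCube`, the root may be 0, so closure under products and powers carries no side
  -- conditions.
  IsCube : Carrier → Set (c ⊔ ℓ)
  IsCube x = ∃[ y ] y ^ 3 ≈ x

  IsCube-resp : ∀ {x y} → x ≈ y → IsCube x → IsCube y
  IsCube-resp x≈y (z , z³≈x) = z , trans z³≈x x≈y

  IsCube-* : ∀ {x y} → IsCube x → IsCube y → IsCube (x * y)
  IsCube-* (u , u³≈x) (v , v³≈y) = u * v , trans (^-distrib-* u v 3) (*-cong u³≈x v³≈y)

  IsCube-cancelˡ : ∀ {x y} → x ≉0 → IsCube x → IsCube (x * y) → IsCube y
  IsCube-cancelˡ {x} {y} x≉0 (u , u³≈x) (v , v³≈xy) = u⁻¹ * v , (begin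
    (u⁻¹ * v) ^ 3        ≈⟨ ^-distrib-* u⁻¹ v 3 ⟩
    u⁻¹ ^ 3 * v ^ 3      ≈⟨ *-congˡ (trans v³≈xy (*-congʳ (sym u³≈x))) ⟩
    u⁻¹ ^ 3 * (u ^ 3 * y) ≈⟨ *-assoc _ _ y ⟨
    u⁻¹ ^ 3 * u ^ 3 * y  ≈⟨ *-congʳ (^-distrib-* u⁻¹ u 3) ⟨
    (u⁻¹ * u) ^ 3 * y    ≈⟨ *-congʳ (^-congˡ 3 (proj₁ (proj₂ (invertible u≉0)))) ⟩
    1# ^ 3 * y           ≈⟨ *-congʳ (1^n≈1 3) ⟩
    1# * y               ≈⟨ *-identityˡ y ⟩
    y                    ∎)
    where
    u≉0 : u ≉0
    u≉0 u≈0 = x≉0 (trans (sym u³≈x) (trans (*-congʳ u≈0) (zeroˡ _)))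
    u⁻¹ = u ⁻¹⟨ u≉0 ⟩

  IsCube-^ : ∀ x {n} k → n ≡ k ℕ.* 3 → IsCube (x ^ n)
  IsCube-^ x k n≡3k = x ^ k , trans (^-assocʳ x k 3) (^-congʳ x (≡.sym n≡3k))

  -- Then 3(2j + 1) + 1 = 2Q, so that the cube of x²ʲ⁺¹ is x^2Q / x = x.
  x^Q≈x⇒IsCube : ∀ {x Q} j → Q ≡ 2 ℕ.+ j ℕ.* 3 → x ≉0 → x ^ Q ≈ x → IsCube x
  x^Q≈x⇒IsCube {x} {Q} j Q≡ x≉0 x^Q≈x = x ^ (1 ℕ.+ j ℕ.* 2) , *-cancelˡ x≉0 (begin
    x * (x ^ (1 ℕ.+ j ℕ.* 2)) ^ 3         ≈⟨ *-congˡ (^-assocʳ x (1 ℕ.+ j ℕ.* 2) 3) ⟩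
    x ^ (1 ℕ.+ (1 ℕ.+ j ℕ.* 2) ℕ.* 3)     ≈⟨ ^-congʳ x (≡.trans (exponents j) (≡.sym (≡.cong₂ ℕ._+_ Q≡ Q≡))) ⟩
    x ^ (Q ℕ.+ Q)                         ≈⟨ ^-homo-* x Q Q ⟩
    x ^ Q * x ^ Q                         ≈⟨ *-cong x^Q≈x x^Q≈x ⟩
    x * x                                 ∎)
    where
    exponents : ∀ j → 1 ℕ.+ (1 ℕ.+ j ℕ.* 2) ℕ.* 3 ≡ (2 ℕ.+ j ℕ.* 3) ℕ.+ (2 ℕ.+ j ℕ.* 3)
    exponents = solve-∀

  -- uʳ and yʳ agree with u and y up to cubes.
  twisted-proportional⇒IsCube : ∀ {B a u y r} i → r ≡ 1 ℕ.+ i ℕ.* 3 → IsCube a →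
    u ≉0 → y ≉0 → B * (u ^ r * y) ≈ a * (u * y ^ r) → IsCube B
  twisted-proportional⇒IsCube {B} {a} {u} {y} {r} i r≡ a-cube u≉0 y≉0 eq =
    IsCube-cancelˡ (^-≉0 3i u≉0) (IsCube-^ u i ≡.refl)
      (IsCube-resp (sym (*-cancelˡ (*-≉0 u≉0 y≉0) (begin
        u * y * (u ^ 3i * B)     ≈⟨ solve 4 (λ u y v B → (u ⊕ y) ⊕ (v ⊕ B) ⊜ B ⊕ ((u ⊕ v) ⊕ y)) refl u y (u ^ 3i) B ⟩
        B * (u ^ (1 ℕ.+ 3i) * y) ≈⟨ *-congˡ (*-congʳ (^-congʳ u r≡)) ⟨
        B * (u ^ r * y)          ≈⟨ eq ⟩
        a * (u * y ^ r)          ≈⟨ *-congˡ (*-congˡ (^-congʳ y r≡)) ⟩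
        a * (u * (y * y ^ 3i))   ≈⟨ solve 4 (λ u y v a → a ⊕ (u ⊕ (y ⊕ v)) ⊜ (u ⊕ y) ⊕ (a ⊕ v)) refl u y (y ^ 3i) a ⟩
        u * y * (a * y ^ 3i)     ∎)))
        (IsCube-* a-cube (IsCube-^ y i ≡.refl)))
    where
    3i = i ℕ.* 3
    open CommutativeMonoidSolver *-commutativeMonoid using (solve; _⊕_; _⊜_)

-- Finite fields: Fermat's identity and the characteristic.

module FiniteField (M : Field c ℓ) {n : ℕ} (M≅n : IsFiniteFieldOfOrder n M) where
  open Field M hiding (zero)
  open FieldProperties M
  open FiniteSetoid M≅n public using (_≟_)
  open FiniteSetoid M≅n using (element; element-index; sum-reindex)
  open SetoidReasoning setoid
  open RingProperties ring using (+-cancelʳ)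

  x^k≈0⇒x≈0 : ∀ {x} k → x ^ k ≈ 0# → x ≈ 0#
  x^k≈0⇒x≈0 {x} k x^k≈0 with x ≟ 0#
  ... | yes x≈0 = x≈0
  ... | no  x≉0 = contradiction x^k≈0 (^-≉0 k x≉0)

  translation : Carrier → Inverse setoid setoid
  translation a = record
    { to        = a +_
    ; from      = - a +_
    ; to-cong   = +-congˡ
    ; from-cong = +-congˡ
    ; inverse   = (λ {x} y≈ → trans (+-congˡ y≈) (cancel a (- a) (-‿inverseʳ a) x))
                , (λ {x} y≈ → trans (+-congˡ y≈) (cancel (- a) a (-‿inverseˡ a) x))
    }
    where
    cancel : ∀ a b → a + b ≈ 0# → ∀ x → a + (b + x) ≈ x
    cancel a b a+b≈0 x = trans (sym (+-assoc a b x)) (trans (+-congʳ a+b≈0) (+-identityˡ x))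

  homothety : (a : Carrier) → a ≉0 → Inverse setoid setoid
  homothety a a≉0 = record
    { to        = a *_
    ; from      = a⁻¹ *_
    ; to-cong   = *-congˡ
    ; from-cong = *-congˡ
    ; inverse   = (λ {x} y≈ → trans (*-congˡ y≈) (cancel a a⁻¹ (proj₂ a⁻¹-inverse) x))
                , (λ {x} y≈ → trans (*-congˡ y≈) (cancel a⁻¹ a (proj₁ a⁻¹-inverse) x))
    }
    where
    a⁻¹ = a ⁻¹⟨ a≉0 ⟩
    a⁻¹-inverse = proj₂ (invertible a≉0)
    cancel : ∀ a b → a * b ≈ 1# → ∀ x → a * (b * x) ≈ x
    cancel a b ab≈1 x = trans (sym (*-assoc a b x)) (trans (*-congʳ ab≈1) (*-identityˡ x))

  module _ where
    open FiniteSum +-commutativeMonoid using (sum; ∑-distrib-+; sum-replicate)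
    open Mult +-monoid using () renaming (_×_ to _·_)

    -- Translation by 1 permutes the field, so the sum of all elements is unchanged when 1 is added
    -- to each of its `n` terms.
    n·1≈0 : n · 1# ≈ 0#
    n·1≈0 = +-cancelʳ (sum element) (n · 1#) 0# $ begin
      n · 1# + sum element                     ≈⟨ +-congʳ (sum-replicate n) ⟨
      sum {n} (λ _ → 1#) + sum element         ≈⟨ ∑-distrib-+ {n} (λ _ → 1#) element ⟨
      sum {n} (λ i → 1# + element i)           ≈⟨ sum-reindex +-commutativeMonoid (translation 1#) (λ x → x) (λ x≈y → x≈y) ⟨
      sum element                              ≈⟨ +-identityˡ (sum element) ⟨
      0# + sum element                         ∎

  private
    module ∏ = FiniteSum *-commutativeMonoid

    -- Products over the nonzero elements are taken over all elements, with the factor at zero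
    -- replaced by 1.
    if0 : Carrier → Carrier → Carrier → Carrier
    if0 a b x with x ≟ 0#
    ... | yes _ = a
    ... | no  _ = b

    if0-yes : ∀ {a b x} → x ≈ 0# → if0 a b x ≈ a
    if0-yes {x = x} x≈0 with x ≟ 0#
    ... | yes _   = refl
    ... | no  x≉0 = contradiction x≈0 x≉0

    if0-no : ∀ {a b x} → x ≉0 → if0 a b x ≈ b
    if0-no {x = x} x≉0 with x ≟ 0#
    ... | yes x≈0 = contradiction x≈0 x≉0
    ... | no  _   = refl

    unit : Carrier → Carrier
    unit x = if0 1# x x

    unit-cong : ∀ {x y} → x ≈ y → unit x ≈ unit y
    unit-cong {x} {y} x≈y with x ≟ 0# | y ≟ 0#
    ... | yes _   | yes _   = refl
    ... | yes x≈0 | no  y≉0 = contradiction (trans (sym x≈y) x≈0) y≉0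
    ... | no  x≉0 | yes y≈0 = contradiction (trans x≈y y≈0) x≉0
    ... | no  _   | no  _   = x≈y

    unit-≉0 : ∀ x → unit x ≉0
    unit-≉0 x with x ≟ 0#
    ... | yes _   = 1≉0
    ... | no  x≉0 = x≉0

    unit-* : ∀ {a} → a ≉0 → ∀ x → unit (a * x) ≈ if0 1# a x * unit x
    unit-* {a} a≉0 x with x ≟ 0#
    ... | yes x≈0 = trans (if0-yes (trans (*-congˡ x≈0) (zeroʳ a))) (sym (*-identityˡ 1#))
    ... | no  x≉0 = if0-no (*-≉0 a≉0 x≉0)

    ∏-≉0 : ∀ {k} (f : Fin k → Carrier) → (∀ i → f i ≉0) → ∏.sum f ≉0
    ∏-≉0 {zero}  f f≉0 = 1≉0
    ∏-≉0 {suc k} f f≉0 = *-≉0 (f≉0 zero) (∏-≉0 (f ∘ suc) (f≉0 ∘ suc))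

    -- All factors but the one at `z` equal `a`; the extra `a` in front makes up for that one, which
    -- avoids the exponent `k - 1`.
    ∏-if0 : ∀ {k} (f : Fin k → Carrier) (z : Fin k) → f z ≈ 0# → (∀ i → ¬ i ≡ z → f i ≉0) →
            ∀ a → a * ∏.sum (if0 1# a ∘ f) ≈ a ^ k
    ∏-if0 {suc k} f z fz≈0 fi≉0 a = *-congˡ $ begin
      ∏.sum (if0 1# a ∘ f)                                    ≈⟨ ∏.sum-remove {i = z} (if0 1# a ∘ f) ⟩
      if0 1# a (f z) * ∏.sum (λ i → if0 1# a (f (punchIn z i))) ≈⟨ *-cong (if0-yes fz≈0) (∏.sum-cong-≋ λ i → if0-no (fi≉0 _ (punchInᵢ≢i z i))) ⟩
      1# * ∏.sum {k} (λ _ → a)                                ≈⟨ *-identityˡ _ ⟩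
      ∏.sum {k} (λ _ → a)                                     ≈⟨ ∏.sum-replicate k ⟩
      a ^ k                                                   ∎

    scaling-product : ∀ a → a * ∏.sum (if0 1# a ∘ element) ≈ a ^ n
    scaling-product = ∏-if0 element (to 0#) (element-index 0#) λ i i≢z e≈0 →
      i≢z (≡.trans (≡.sym (strictlyInverseˡ i)) (to-cong e≈0))
      where open Inverse M≅n

  -- Multiplication by x ≉ 0 permutes the nonzero elements, whose product it scales by xⁿ⁻¹.
  x^n≈x : ∀ x → x ^ n ≈ x
  x^n≈x x with x ≟ 0#
  ... | yes x≈0 = begin
    x ^ n   ≈⟨ scaling-product x ⟨
    x * _   ≈⟨ *-congʳ x≈0 ⟩
    0# * _  ≈⟨ zeroˡ _ ⟩
    0#      ≈⟨ x≈0 ⟨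
    x       ∎
  ... | no x≉0 = begin
    x ^ n     ≈⟨ scaling-product x ⟨
    x * ∏if0  ≈⟨ *-congˡ ∏if0≈1 ⟩
    x * 1#    ≈⟨ *-identityʳ x ⟩
    x         ∎
    where
    ∏if0 = ∏.sum (if0 1# x ∘ element)
    ∏units = ∏.sum (unit ∘ element)
    ∏if0≈1 : ∏if0 ≈ 1#
    ∏if0≈1 = *-cancelˡ (∏-≉0 (unit ∘ element) (unit-≉0 ∘ element)) $ begin
      ∏units * ∏if0                                             ≈⟨ *-comm ∏units ∏if0 ⟩
      ∏if0 * ∏units                                             ≈⟨ ∏.∑-distrib-+ (if0 1# x ∘ element) (unit ∘ element) ⟨
      ∏.sum (λ i → if0 1# x (element i) * unit (element i))     ≈⟨ ∏.sum-cong-≋ (λ i → unit-* x≉0 (element i)) ⟨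
      ∏.sum (λ i → unit (x * element i))                        ≈⟨ sum-reindex *-commutativeMonoid (homothety x x≉0) unit unit-cong ⟨
      ∏units                                                    ≈⟨ *-identityʳ ∏units ⟨
      ∏units * 1#                                               ∎

  -- `n · 1#` is the `m`-th power of `1# + 1#`, and a field has no nonzero nilpotents.
  n≡2^m⇒1+1≈0 : ∀ m → n ≡ 2 ℕ.^ m → 1# + 1# ≈ 0#
  n≡2^m⇒1+1≈0 m n≡2^m = trans (+-congˡ (sym (+-identityʳ 1#)))
    (x^k≈0⇒x≈0 m (trans (sym (2^k·1≈ m)) (trans (×-congˡ (≡.sym n≡2^m)) n·1≈0)))
    where
    open SemiringMult semiring using (×1-homo-*) renaming (_×_ to _·_)
    open Mult +-monoid using (×-congˡ)
    2^k·1≈ : ∀ k → (2 ℕ.^ k) · 1# ≈ (2 · 1#) ^ k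
    2^k·1≈ zero    = +-identityʳ 1#
    2^k·1≈ (suc k) = trans (×1-homo-* 2 (2 ℕ.^ k)) (*-congˡ (2^k·1≈ k))

-- A criterion for a map to be APN.

-- Solutions come in pairs {z, z ∙ a}, so it suffices that there is at most one pair.
module _ (V : AbelianGroup c ℓ) {n : ℕ} (V≅n : HasCardinality (AbelianGroup.setoid V) n) where
  open AbelianGroup V
  open FiniteSetoid V≅n using (_≟_; search)
  open SetoidReasoning setoid

  unique-pair⇒APN : (F : Func setoid setoid) → let open Func F in (∀ x → x ∙ x ≈ ε) →
    (∀ a → ¬ a ≈ ε → ∀ z z′ → to z ∙ to (z ∙ a) ≈ to z′ ∙ to (z′ ∙ a) → z′ ≈ z ⊎ z′ ≈ z ∙ a) →
    APN V F
  unique-pair⇒APN F x∙x≈ε unique a a≉ε d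
    with search {P = λ z → to z ∙ to (z ∙ a) ≈ d}
                (λ x≈y → trans (∙-cong (to-cong (sym x≈y)) (to-cong (∙-congʳ (sym x≈y)))))
                (λ z → (to z ∙ to (z ∙ a)) ≟ d)
    where open Func F renaming (cong to to-cong)
  ... | no ∄z = inj₁ (record
    { to        = λ s → ⊥-elim (∄z s)
    ; from      = λ ()
    ; to-cong   = λ {s} _ → ⊥-elim (∄z s)
    ; from-cong = λ { {()} }
    ; inverse   = (λ { {()} }) , (λ {s} _ → ⊥-elim (∄z s))
    })
  ... | yes (z , Dz≈d) = inj₂ (record
    { to        = index
    ; from      = solution
    ; to-cong   = λ {s} {t} → index-cong {s} {t}
    ; from-cong = λ { {i} ≡.refl → refl {proj₁ (solution i)} }
    ; inverse   = (λ { {i} {s} s≈ → ≡.trans (index-cong {s} {solution i} s≈) (index-solution i) })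
                , (λ { {s} ≡.refl → solution-index s })
    })
    where
    open Func F renaming (cong to to-cong)
    Solution = ∃[ z ] to z ∙ to (z ∙ a) ≈ d

    z∙a∙a≈z : (z ∙ a) ∙ a ≈ z
    z∙a∙a≈z = trans (assoc z a a) (trans (∙-congˡ (x∙x≈ε a)) (identityʳ z))

    z∙a≉z : ¬ z ∙ a ≈ z
    z∙a≉z z∙a≈z = a≉ε (∙-cancelˡ z a ε (trans z∙a≈z (sym (identityʳ z))))
      where open GroupProperties group using (∙-cancelˡ)

    solution : Fin 2 → Solution
    solution zero       = z , Dz≈d
    -- As `a` is its own inverse, translation by `a` exchanges the two terms of the derivative.
    solution (suc zero) = z ∙ a , trans (trans (∙-congˡ (to-cong z∙a∙a≈z)) (comm _ _)) Dz≈d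

    -- Everything other than `z` gets index 1; that only `z ∙ a` can occur there is the content of
    -- `unique`, used in `solution-index`.
    index : Solution → Fin 2
    index (z′ , _) with z′ ≟ z
    ... | yes _ = zero
    ... | no  _ = suc zero

    index-cong : ∀ {s t} → proj₁ s ≈ proj₁ t → index s ≡ index t
    index-cong {z₁ , _} {z₂ , _} z₁≈z₂ with z₁ ≟ z | z₂ ≟ z
    ... | yes _    | yes _    = ≡.refl
    ... | yes z₁≈z | no  z₂≉z = contradiction (trans (sym z₁≈z₂) z₁≈z) z₂≉z
    ... | no  z₁≉z | yes z₂≈z = contradiction (trans z₁≈z₂ z₂≈z) z₁≉z
    ... | no  _    | no  _    = ≡.refl

    index-solution : ∀ i → index (solution i) ≡ i
    index-solution zero with z ≟ z
    ... | yes _   = ≡.refl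
    ... | no  z≉z = contradiction refl z≉z
    index-solution (suc zero) with (z ∙ a) ≟ z
    ... | yes z∙a≈z = contradiction z∙a≈z z∙a≉z
    ... | no  _     = ≡.refl

    solution-index : ∀ s → proj₁ (solution (index s)) ≈ proj₁ s
    solution-index (z′ , Dz′≈d) with z′ ≟ z
    ... | yes z′≈z = sym z′≈z
    ... | no  z′≉z with unique a a≉ε z z′ (trans Dz≈d (sym Dz′≈d))
    ...   | inj₁ z′≈z   = contradiction z′≈z z′≉z
    ...   | inj₂ z′≈z∙a = sym z′≈z∙a

-- Characteristic 2: additivity of Frobenius powers and their fixed elements.

HasCharacteristic2 : Field c ℓ → Set ℓ
HasCharacteristic2 M = 1# + 1# ≈ 0#
  where open Field M

module Characteristic2 (M : Field c ℓ) (1+1≈0 : HasCharacteristic2 M) where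
  open Field M hiding (zero)
  open FieldProperties M
  open SetoidReasoning setoid

  private
    module F₂ = CommutativeRing xor-∧-commutativeRing

    F₂⟶M : F₂.rawRing -Raw-AlmostCommutative⟶ fromCommutativeRing commutativeRing
    F₂⟶M = record
      { ⟦_⟧    = ⟦_⟧
      ; +-homo = λ { false y → sym (+-identityˡ ⟦ y ⟧)
                   ; true false → sym (+-identityʳ 1#)
                   ; true true → sym 1+1≈0 }
      ; *-homo = λ { false y → sym (zeroˡ ⟦ y ⟧) ; true y → sym (*-identityˡ ⟦ y ⟧) }
      ; -‿homo = λ { false → sym -0#≈0#
                   ; true → +-cancelʳ 1# 1# (- 1#) (trans 1+1≈0 (sym (-‿inverseˡ 1#))) }
      ; 0-homo = refl
      ; 1-homo = refl
      }
      where
      open RingProperties ring using (-0#≈0#; +-cancelʳ)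
      ⟦_⟧ : Bool → Carrier
      ⟦ false ⟧ = 0#
      ⟦ true  ⟧ = 1#

    ⟦_⟧≟⟦_⟧ : WeaklyDecidable (Induced-equivalence F₂⟶M)
    ⟦ false ⟧≟⟦ false ⟧ = just refl
    ⟦ true  ⟧≟⟦ true  ⟧ = just refl
    ⟦ _     ⟧≟⟦ _     ⟧ = nothing

  -- With coefficients in 𝔽₂ the ring solver knows that x + x ≈ 0.
  open RingSolver F₂.rawRing (fromCommutativeRing commutativeRing) F₂⟶M ⟦_⟧≟⟦_⟧ public
    using (solve; _:=_; _:+_; _:*_; _:^_; con)

  x+x≈0 : ∀ x → x + x ≈ 0#
  x+x≈0 = solve 1 (λ x → x :+ x := con false) refl

  x≈y⇒x+y≈0 : ∀ {x y} → x ≈ y → x + y ≈ 0#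
  x≈y⇒x+y≈0 {y = y} x≈y = trans (+-congʳ x≈y) (x+x≈0 y)

  x+y≈0⇒x≈y : ∀ {x y} → x + y ≈ 0# → x ≈ y
  x+y≈0⇒x≈y {x} {y} x+y≈0 = begin
    x            ≈⟨ solve 2 (λ x y → x := x :+ y :+ y) refl x y ⟩
    x + y + y    ≈⟨ +-congʳ x+y≈0 ⟩
    0# + y       ≈⟨ +-identityˡ y ⟩
    y            ∎

  [x+y]²≈x²+y² : ∀ x y → (x + y) ^ 2 ≈ x ^ 2 + y ^ 2
  [x+y]²≈x²+y² = solve 2 (λ x y → (x :+ y) :^ 2 := x :^ 2 :+ y :^ 2) refl

  -- Induction on `k`: squaring is additive because the cross term is doubled.
  frobenius-+ : ∀ k x y → (x + y) ^ (2 ℕ.^ k) ≈ x ^ (2 ℕ.^ k) + y ^ (2 ℕ.^ k)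
  frobenius-+ zero    x y = solve 2 (λ x y → (x :+ y) :^ 1 := x :^ 1 :+ y :^ 1) refl x y
  frobenius-+ (suc k) x y = begin
    (x + y) ^ (2 ℕ.* 2 ℕ.^ k)                         ≈⟨ ^-assocʳ (x + y) 2 (2 ℕ.^ k) ⟨
    ((x + y) ^ 2) ^ (2 ℕ.^ k)                         ≈⟨ ^-congˡ (2 ℕ.^ k) ([x+y]²≈x²+y² x y) ⟩
    (x ^ 2 + y ^ 2) ^ (2 ℕ.^ k)                       ≈⟨ frobenius-+ k (x ^ 2) (y ^ 2) ⟩
    (x ^ 2) ^ (2 ℕ.^ k) + (y ^ 2) ^ (2 ℕ.^ k)         ≈⟨ +-cong (^-assocʳ x 2 (2 ℕ.^ k)) (^-assocʳ y 2 (2 ℕ.^ k)) ⟩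
    x ^ (2 ℕ.* 2 ℕ.^ k) + y ^ (2 ℕ.* 2 ℕ.^ k)         ∎

  -- Writing 0 as `1# + 1#` lets additivity do the work, without exhibiting `2 ^ k` as a successor.
  x≈0⇒x^2^k≈0 : ∀ k {x} → x ≈ 0# → x ^ (2 ℕ.^ k) ≈ 0#
  x≈0⇒x^2^k≈0 k {x} x≈0 = begin
    x ^ (2 ℕ.^ k)                        ≈⟨ ^-congˡ (2 ℕ.^ k) (trans x≈0 (sym (x+x≈0 1#))) ⟩
    (1# + 1#) ^ (2 ℕ.^ k)                ≈⟨ frobenius-+ k 1# 1# ⟩
    1# ^ (2 ℕ.^ k) + 1# ^ (2 ℕ.^ k)      ≈⟨ x+x≈0 _ ⟩
    0#                                   ∎

  -- Separates the two terms of a component of F in a sum of four of its values, so that each term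
  -- can be polarised by itself.
  regroup : ∀ e p₁ p₂ p₃ p₄ r₁ r₂ r₃ r₄ →
    (p₁ + e * r₁ + (p₂ + e * r₂)) + (p₃ + e * r₃ + (p₄ + e * r₄)) ≈
    ((p₁ + p₂) + (p₃ + p₄)) + e * ((r₁ + r₂) + (r₃ + r₄))
  regroup = solve 9 (λ e p₁ p₂ p₃ p₄ r₁ r₂ r₃ r₄ →
    (p₁ :+ e :* r₁ :+ (p₂ :+ e :* r₂)) :+ (p₃ :+ e :* r₃ :+ (p₄ :+ e :* r₄)) :=
    ((p₁ :+ p₂) :+ (p₃ :+ p₄)) :+ e :* ((r₁ :+ r₂) :+ (r₃ :+ r₄))) refl

  -- For the product of two additive maps, the two first-order differences in direction (h, k)
  -- differ by a bilinear expression: this linearises the equation defining APNness.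
  polarisation : ∀ a b a′ b′ h k →
    (a * b + (a + h) * (b + k)) + (a′ * b′ + (a′ + h) * (b′ + k)) ≈ (a + a′) * k + h * (b + b′)
  polarisation = solve 6 (λ a b a′ b′ h k →
    (a :* b :+ (a :+ h) :* (b :+ k)) :+ (a′ :* b′ :+ (a′ :+ h) :* (b′ :+ k)) :=
    (a :+ a′) :* k :+ h :* (b :+ b′)) refl

  x^2≈x⇒x≈0⊎x≈1 : Decidable _≈_ → ∀ {x} → x ^ 2 ≈ x → x ≈ 0# ⊎ x ≈ 1#
  x^2≈x⇒x≈0⊎x≈1 _≟_ {x} x²≈x with x ≟ 0#
  ... | yes x≈0 = inj₁ x≈0
  ... | no  x≉0 = inj₂ (*-cancelˡ x≉0 (trans (solve 1 (λ x → x :* x := x :^ 2) refl x)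
                                              (trans x²≈x (sym (*-identityʳ x)))))

  x^2^k≈x⇒x^2^[ik]≈x : ∀ {x} k → x ^ (2 ℕ.^ k) ≈ x → ∀ i → x ^ (2 ℕ.^ (i ℕ.* k)) ≈ x
  x^2^k≈x⇒x^2^[ik]≈x {x} k fixed zero    = *-identityʳ x
  x^2^k≈x⇒x^2^[ik]≈x {x} k fixed (suc i) = begin
    x ^ (2 ℕ.^ (k ℕ.+ i ℕ.* k))           ≈⟨ ^-congʳ x (ℕₚ.^-distribˡ-+-* 2 k (i ℕ.* k)) ⟩
    x ^ (2 ℕ.^ k ℕ.* 2 ℕ.^ (i ℕ.* k))     ≈⟨ ^-assocʳ x (2 ℕ.^ k) (2 ℕ.^ (i ℕ.* k)) ⟨
    (x ^ (2 ℕ.^ k)) ^ (2 ℕ.^ (i ℕ.* k))   ≈⟨ ^-congˡ (2 ℕ.^ (i ℕ.* k)) fixed ⟩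
    x ^ (2 ℕ.^ (i ℕ.* k))                 ≈⟨ x^2^k≈x⇒x^2^[ik]≈x k fixed i ⟩
    x                                     ∎

  -- Both `i * k` and `1 + i * k` squarings fix `x`, hence so does a single one.
  consecutive-fixed⇒x^2≈x : ∀ {x} i k → x ^ (2 ℕ.^ k) ≈ x → ∀ j m → x ^ (2 ℕ.^ m) ≈ x →
    1 ℕ.+ i ℕ.* k ≡ j ℕ.* m → x ^ 2 ≈ x
  consecutive-fixed⇒x^2≈x {x} i k fixedₖ j m fixedₘ 1+ik≡jm = begin
    x ^ 2                            ≈⟨ ^-congˡ 2 (x^2^k≈x⇒x^2^[ik]≈x k fixedₖ i) ⟨
    (x ^ (2 ℕ.^ (i ℕ.* k))) ^ 2      ≈⟨ ^-comm x (2 ℕ.^ (i ℕ.* k)) 2 ⟩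
    (x ^ 2) ^ (2 ℕ.^ (i ℕ.* k))      ≈⟨ ^-assocʳ x 2 (2 ℕ.^ (i ℕ.* k)) ⟩
    x ^ (2 ℕ.^ (1 ℕ.+ i ℕ.* k))      ≈⟨ ^-congʳ x (≡.cong (2 ℕ.^_) 1+ik≡jm) ⟩
    x ^ (2 ℕ.^ (j ℕ.* m))            ≈⟨ x^2^k≈x⇒x^2^[ik]≈x m fixedₘ j ⟩
    x                                ∎

  -- By Bézout some multiples of `k` and `m` differ by 1; which of them is larger decides the order
  -- of the arguments.
  coprime-fixed⇒x^2≈x : ∀ {x} k m → gcd k m ≡ 1 → x ^ (2 ℕ.^ k) ≈ x → x ^ (2 ℕ.^ m) ≈ x → x ^ 2 ≈ x
  coprime-fixed⇒x^2≈x {x} k m gcd≡1 fixedₖ fixedₘ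
    with Bézout.identity (≡.subst (GCD k m) gcd≡1 (gcd-GCD k m))
  ... | Bézout.+- i j 1+jm≡ik = consecutive-fixed⇒x^2≈x j m fixedₘ i k fixedₖ 1+jm≡ik
  ... | Bézout.-+ i j 1+ik≡jm = consecutive-fixed⇒x^2≈x i k fixedₖ j m fixedₘ 1+ik≡jm

-- The involution x̄ and powers modulo cubes.

-- 𝕂 enters only as the set of fixed elements of the involution x ↦ x^Q of 𝕄, written x̄ below.
module Kernel (M : Field c ℓ) {m : ℕ} (∣M∣≡2^m : IsFiniteFieldOfOrder (2 ℕ.^ m) M)
  (k h : ℕ) (gcd≡1 : gcd k m ≡ 1) (h+h≡m : h ℕ.+ h ≡ m)
  (i j : ℕ) (q≡ : 2 ℕ.^ k ≡ 2 ℕ.+ i ℕ.* 3) (Q≡ : 2 ℕ.^ h ≡ 2 ℕ.+ j ℕ.* 3)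
  where
  open Field M hiding (zero)
  open FieldProperties M
  open FiniteField M ∣M∣≡2^m
  open Characteristic2 M (n≡2^m⇒1+1≈0 m ≡.refl) public
  open SetoidReasoning setoid

  q Q : ℕ
  q = 2 ℕ.^ k
  Q = 2 ℕ.^ h

  r : ℕ
  r = q ℕ.* Q

  -- The quotient in (2 + 3i)(2 + 3j) = 4 + 6i + 6j + 9ij = 1 + 3l.
  l : ℕ
  l = 1 ℕ.+ i ℕ.* 2 ℕ.+ j ℕ.* 2 ℕ.+ i ℕ.* j ℕ.* 3

  r≡ : r ≡ 1 ℕ.+ l ℕ.* 3
  r≡ = ≡.trans (≡.cong₂ ℕ._*_ q≡ Q≡) (expand i j)
    where
    expand : ∀ i j → (2 ℕ.+ i ℕ.* 3) ℕ.* (2 ℕ.+ j ℕ.* 3) ≡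
                     1 ℕ.+ (1 ℕ.+ i ℕ.* 2 ℕ.+ j ℕ.* 2 ℕ.+ i ℕ.* j ℕ.* 3) ℕ.* 3
    expand = solve-∀

  [x^Q]^Q≈x : ∀ x → (x ^ Q) ^ Q ≈ x
  [x^Q]^Q≈x x = begin
    (x ^ Q) ^ Q             ≈⟨ ^-assocʳ x Q Q ⟩
    x ^ (Q ℕ.* Q)           ≈⟨ ^-congʳ x (ℕₚ.^-distribˡ-+-* 2 h h) ⟨
    x ^ (2 ℕ.^ (h ℕ.+ h))   ≈⟨ ^-congʳ x (≡.cong (2 ℕ.^_) h+h≡m) ⟩
    x ^ (2 ℕ.^ m)           ≈⟨ x^n≈x x ⟩
    x                       ∎

  -- Every `x` is also fixed by the `2 ^ m`-th power, and `k` is coprime to `m`; so `x` is fixed by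
  -- squaring.
  x^q≈x⇒x≈0⊎x≈1 : ∀ {x} → x ^ q ≈ x → x ≈ 0# ⊎ x ≈ 1#
  x^q≈x⇒x≈0⊎x≈1 {x} x^q≈x =
    x^2≈x⇒x≈0⊎x≈1 _≟_ (coprime-fixed⇒x^2≈x k m gcd≡1 x^q≈x (x^n≈x x))

  [x^q]^Q≈x^r : ∀ x → (x ^ q) ^ Q ≈ x ^ r
  [x^q]^Q≈x^r x = ^-assocʳ x q Q

  [x^Q]^q≈x^r : ∀ x → (x ^ Q) ^ q ≈ x ^ r
  [x^Q]^q≈x^r x = trans (^-comm x Q q) ([x^q]^Q≈x^r x)

  [x^r]^Q≈x^q : ∀ x → (x ^ r) ^ Q ≈ x ^ q
  [x^r]^Q≈x^q x = trans (^-congˡ Q (sym ([x^q]^Q≈x^r x))) ([x^Q]^Q≈x (x ^ q))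

  ^q-+ : ∀ x y → (x + y) ^ q ≈ x ^ q + y ^ q
  ^q-+ = frobenius-+ k

  ^Q-+ : ∀ x y → (x + y) ^ Q ≈ x ^ Q + y ^ Q
  ^Q-+ = frobenius-+ h

  ^r-+ : ∀ x y → (x + y) ^ r ≈ x ^ r + y ^ r
  ^r-+ x y = begin
    (x + y) ^ r                ≈⟨ [x^q]^Q≈x^r (x + y) ⟨
    ((x + y) ^ q) ^ Q          ≈⟨ ^-congˡ Q (^q-+ x y) ⟩
    (x ^ q + y ^ q) ^ Q        ≈⟨ ^Q-+ (x ^ q) (y ^ q) ⟩
    (x ^ q) ^ Q + (y ^ q) ^ Q  ≈⟨ +-cong ([x^q]^Q≈x^r x) ([x^q]^Q≈x^r y) ⟩
    x ^ r + y ^ r              ∎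

  x≈0⇒x^r≈0 : ∀ {x} → x ≈ 0# → x ^ r ≈ 0#
  x≈0⇒x^r≈0 x≈0 = trans (sym ([x^q]^Q≈x^r _)) (x≈0⇒x^2^k≈0 h (x≈0⇒x^2^k≈0 k x≈0))

  1^Q≈1 : 1# ^ Q ≈ 1#
  1^Q≈1 = 1^n≈1 Q

  -- The exponent `q + 2Q` is 2 + 4 = 6 modulo 3. Since x̄ · x̄² is a cube as well, this expresses
  -- that `x ^ q` and x̄ agree modulo cubes.
  x^q*[x^Q]²-IsCube : ∀ x → IsCube (x ^ q * (x ^ Q * x ^ Q))
  x^q*[x^Q]²-IsCube x = IsCube-resp
    (trans (^-homo-* x q (Q ℕ.+ Q)) (*-congˡ (^-homo-* x Q Q)))
    (IsCube-^ x (2 ℕ.+ i ℕ.+ j ℕ.* 2) (≡.trans (≡.cong₂ (λ q Q → q ℕ.+ (Q ℕ.+ Q)) q≡ Q≡) (expand i j)))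
    where
    expand : ∀ i j → (2 ℕ.+ i ℕ.* 3) ℕ.+ ((2 ℕ.+ j ℕ.* 3) ℕ.+ (2 ℕ.+ j ℕ.* 3)) ≡
                     (2 ℕ.+ i ℕ.+ j ℕ.* 2) ℕ.* 3
    expand = solve-∀

  -- The normalised system in `s` and `t`.

  module Normalised {b A} (b-nonCube : ¬ IsCube b) (A≉0 : A ≉0) (A^Q≈A : A ^ Q ≈ A)
    (nondegenerate : ¬ b ^ (q ℕ.+ r) ≈ A ^ (q ℕ.+ 1))
    {s t} (eq₁ : s ^ q + s ≈ b * (t ^ q + t)) (eq₂ : b * (s ^ r + t) ≈ A * (s + t ^ r))
    where

    b̄ = b ^ Q
    s̄ = s ^ Q
    t̄ = t ^ Q
    p = s + t̄
    -- `p̄`, and likewise `T̄` below, is a conjugate in expanded form, so that the ring solver can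
    -- take it apart.
    p̄ = s̄ + t
    T = t ^ q + t
    T̄ = t ^ r + t̄
    δ = b * b̄ + A

    p^Q≈p̄ : p ^ Q ≈ p̄
    p^Q≈p̄ = trans (^Q-+ s t̄) (+-congˡ ([x^Q]^Q≈x t))

    p̄^Q≈p : p̄ ^ Q ≈ p
    p̄^Q≈p = trans (^Q-+ s̄ t) (+-congʳ ([x^Q]^Q≈x s))

    T̄^Q≈T : T̄ ^ Q ≈ T
    T̄^Q≈T = trans (^Q-+ (t ^ r) t̄) (+-cong ([x^r]^Q≈x^q t) ([x^Q]^Q≈x t))

    δ^Q≈δ : δ ^ Q ≈ δ
    δ^Q≈δ = begin
      δ ^ Q                    ≈⟨ ^Q-+ (b * b̄) A ⟩
      (b * b̄) ^ Q + A ^ Q      ≈⟨ +-cong (^-distrib-* b b̄ Q) A^Q≈A ⟩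
      b̄ * b̄ ^ Q + A            ≈⟨ +-congʳ (*-congˡ ([x^Q]^Q≈x b)) ⟩
      b̄ * b + A                ≈⟨ +-congʳ (*-comm b̄ b) ⟩
      δ                        ∎

    eq̄₁ : s ^ r + s̄ ≈ b̄ * T̄
    eq̄₁ = begin
      s ^ r + s̄               ≈⟨ +-congʳ ([x^q]^Q≈x^r s) ⟨
      (s ^ q) ^ Q + s̄         ≈⟨ ^Q-+ (s ^ q) s ⟨
      (s ^ q + s) ^ Q         ≈⟨ ^-congˡ Q eq₁ ⟩
      (b * T) ^ Q             ≈⟨ ^-distrib-* b T Q ⟩
      b̄ * T ^ Q               ≈⟨ *-congˡ (^Q-+ (t ^ q) t) ⟩
      b̄ * ((t ^ q) ^ Q + t̄)   ≈⟨ *-congˡ (+-congʳ ([x^q]^Q≈x^r t)) ⟩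
      b̄ * T̄                   ∎

    -- Adding `b` times `eq̄₁` to `eq₂` eliminates `s ^ r`; what remains is collected in `T̄`, `p`
    -- and `p̄`.
    δT̄≈Ap+bp̄ : δ * T̄ ≈ A * p + b * p̄
    δT̄≈Ap+bp̄ = begin
      δ * T̄
        ≈⟨ solve 9 (λ b b̄ A s t s̄ t̄ sʳ tʳ →
             (b :* b̄ :+ A) :* (tʳ :+ t̄) :=
             (A :* (s :+ t̄) :+ b :* (s̄ :+ t)) :+
             (b :* (sʳ :+ s̄ :+ b̄ :* (tʳ :+ t̄)) :+ (b :* (sʳ :+ t) :+ A :* (s :+ tʳ))))
             refl b b̄ A s t s̄ t̄ (s ^ r) (t ^ r) ⟩
      (A * p + b * p̄) + (b * (s ^ r + s̄ + b̄ * T̄) + (b * (s ^ r + t) + A * (s + t ^ r)))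
        ≈⟨ +-congˡ (+-cong (*-congˡ (x≈y⇒x+y≈0 eq̄₁)) (x≈y⇒x+y≈0 eq₂)) ⟩
      (A * p + b * p̄) + (b * 0# + 0#)
        ≈⟨ solve 2 (λ x b → x :+ (b :* con false :+ con false) := x) refl (A * p + b * p̄) b ⟩
      A * p + b * p̄ ∎

    -- The conjugate of `δT̄≈Ap+bp̄`, as `δ` and `A` are fixed.
    δT≈Ap̄+b̄p : δ * T ≈ A * p̄ + b̄ * p
    δT≈Ap̄+b̄p = begin
      δ * T                       ≈⟨ *-cong δ^Q≈δ T̄^Q≈T ⟨
      δ ^ Q * T̄ ^ Q               ≈⟨ ^-distrib-* δ T̄ Q ⟨
      (δ * T̄) ^ Q                 ≈⟨ ^-congˡ Q δT̄≈Ap+bp̄ ⟩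
      (A * p + b * p̄) ^ Q         ≈⟨ ^Q-+ (A * p) (b * p̄) ⟩
      (A * p) ^ Q + (b * p̄) ^ Q   ≈⟨ +-cong (^-distrib-* A p Q) (^-distrib-* b p̄ Q) ⟩
      A ^ Q * p ^ Q + b̄ * p̄ ^ Q   ≈⟨ +-cong (*-cong A^Q≈A p^Q≈p̄) (*-congˡ p̄^Q≈p) ⟩
      A * p̄ + b̄ * p               ∎

    p^q≈ : p ^ q ≈ s ^ q + t ^ r
    p^q≈ = trans (^q-+ s t̄) (+-congˡ ([x^Q]^q≈x^r t))

    -- The `q`-th power of `t̄` is `t ^ r`, so the part in `t` is `T̄`, while `eq₁` gives the part
    -- in `s`.
    p^q+p≈bT+T̄ : p ^ q + p ≈ b * T + T̄
    p^q+p≈bT+T̄ = begin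
      p ^ q + p                          ≈⟨ +-congʳ p^q≈ ⟩
      s ^ q + t ^ r + (s + t̄)            ≈⟨ solve 4 (λ a b c d → a :+ b :+ (c :+ d) := a :+ c :+ (b :+ d)) refl (s ^ q) (t ^ r) s t̄ ⟩
      s ^ q + s + T̄                      ≈⟨ +-congʳ eq₁ ⟩
      b * T + T̄                          ∎

    -- After multiplication by `δ`, both `T` and `T̄` can be expressed through `p` and `p̄`. The
    -- terms in `p` alone add up to `(b * b̄ + A) * p` and cancel `δ * p`.
    δp^q≈b[A+1]p̄ : δ * p ^ q ≈ b * ((A + 1#) * p̄)
    δp^q≈b[A+1]p̄ = begin
      δ * p ^ q
        ≈⟨ solve 3 (λ δ pq p → δ :* pq := δ :* (pq :+ p) :+ δ :* p) refl δ (p ^ q) p ⟩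
      δ * (p ^ q + p) + δ * p
        ≈⟨ +-congʳ (*-congˡ p^q+p≈bT+T̄) ⟩
      δ * (b * T + T̄) + δ * p
        ≈⟨ solve 5 (λ δ b T T̄ p → δ :* (b :* T :+ T̄) :+ δ :* p := b :* (δ :* T) :+ δ :* T̄ :+ δ :* p) refl δ b T T̄ p ⟩
      b * (δ * T) + δ * T̄ + δ * p
        ≈⟨ +-congʳ (+-cong (*-congˡ δT≈Ap̄+b̄p) δT̄≈Ap+bp̄) ⟩
      b * (A * p̄ + b̄ * p) + (A * p + b * p̄) + δ * p
        ≈⟨ solve 5 (λ b b̄ A p p̄ →
             b :* (A :* p̄ :+ b̄ :* p) :+ (A :* p :+ b :* p̄) :+ (b :* b̄ :+ A) :* p :=
             b :* ((A :+ con true) :* p̄)) refl b b̄ A p p̄ ⟩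
      b * ((A + 1#) * p̄) ∎

    p̄≉0 : p ≉0 → p̄ ≉0
    p̄≉0 p≉0 p̄≈0 = p≉0 (trans (sym p̄^Q≈p) (x≈0⇒x^2^k≈0 h p̄≈0))

    -- `b ^ (q + r)` is the `q`-th power of the norm `b * b̄`, so both sides of `nondegenerate`
    -- would be 1. Both degenerate situations below end here.
    ¬[A≈1×N≈1] : A ≈ 1# → b * b̄ ≈ 1# → ⊥
    ¬[A≈1×N≈1] A≈1 N≈1 = nondegenerate (begin
      b ^ (q ℕ.+ r)         ≈⟨ ^-homo-* b q r ⟩
      b ^ q * b ^ r         ≈⟨ *-congˡ ([x^Q]^q≈x^r b) ⟨
      b ^ q * b̄ ^ q         ≈⟨ ^-distrib-* b b̄ q ⟨
      (b * b̄) ^ q           ≈⟨ ^-congˡ q N≈1 ⟩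
      1# ^ q                ≈⟨ 1^n≈1 q ⟩
      1#                    ≈⟨ 1^n≈1 (q ℕ.+ 1) ⟨
      1# ^ (q ℕ.+ 1)        ≈⟨ ^-congˡ (q ℕ.+ 1) A≈1 ⟨
      A ^ (q ℕ.+ 1)         ∎)

    -- Here b p̄ ≈ A p, so that N(b) N(p) ≈ A² N(p), whereas δ ≈ 0 says N(b) ≈ A.
    δ≈0⇒p≈0 : δ ≈ 0# → p ≈ 0#
    δ≈0⇒p≈0 δ≈0 with p ≟ 0#
    ... | yes p≈0 = p≈0
    ... | no  p≉0 = ⊥-elim (¬[A≈1×N≈1] A≈1 (trans N≈A A≈1))
      where
      N≈A : b * b̄ ≈ A
      N≈A = x+y≈0⇒x≈y δ≈0
      Ap≈bp̄ : A * p ≈ b * p̄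
      Ap≈bp̄ = x+y≈0⇒x≈y (trans (sym δT̄≈Ap+bp̄) (trans (*-congʳ δ≈0) (zeroˡ T̄)))
      Ap̄≈b̄p : A * p̄ ≈ b̄ * p
      Ap̄≈b̄p = x+y≈0⇒x≈y (trans (sym δT≈Ap̄+b̄p) (trans (*-congʳ δ≈0) (zeroˡ T)))
      A≈1 : A ≈ 1#
      A≈1 = *-cancelˡ (*-≉0 A≉0 p≉0) (begin
        A * p * A        ≈⟨ *-congʳ Ap≈bp̄ ⟩
        b * p̄ * A        ≈⟨ solve 3 (λ b p̄ A → b :* p̄ :* A := b :* (A :* p̄)) refl b p̄ A ⟩
        b * (A * p̄)      ≈⟨ *-congˡ Ap̄≈b̄p ⟩
        b * (b̄ * p)      ≈⟨ *-assoc b b̄ p ⟨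
        b * b̄ * p        ≈⟨ *-congʳ N≈A ⟩
        A * p            ≈⟨ *-identityʳ (A * p) ⟨
        A * p * 1#       ∎)

    -- δ and A + 1 lie in 𝕂, hence are cubes, and p^q ≈ p̄ modulo cubes; b is not a cube.
    δ≉0⇒p≈0 : δ ≉0 → p ≈ 0#
    δ≉0⇒p≈0 δ≉0 with p ≟ 0# | (A + 1#) ≟ 0#
    ... | yes p≈0 | _         = p≈0
    -- Here `A + 1#` cannot be cancelled as a cube, but the right side of `δp^q≈b[A+1]p̄` vanishes
    -- while the left side does not.
    ... | no  p≉0 | yes A+1≈0 = contradiction
      (trans δp^q≈b[A+1]p̄ (trans (*-congˡ (trans (*-congʳ A+1≈0) (zeroˡ p̄))) (zeroʳ b)))
      (*-≉0 δ≉0 (^-≉0 q p≉0))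
    ... | no  p≉0 | no  A+1≉0 = ⊥-elim (b-nonCube
      (IsCube-cancelˡ (*-≉0 A+1≉0 (^-≉0 3 (p̄≉0 p≉0)))
        (IsCube-* (x^Q≈x⇒IsCube j Q≡ A+1≉0 [A+1]^Q≈A+1) (p̄ , refl))
        (IsCube-resp (sym [A+1]p̄³b≈)
          (IsCube-* (x^Q≈x⇒IsCube j Q≡ δ≉0 δ^Q≈δ) (x^q*[x^Q]²-IsCube p)))))
      where
      [A+1]^Q≈A+1 : (A + 1#) ^ Q ≈ A + 1#
      [A+1]^Q≈A+1 = trans (^Q-+ A 1#) (+-cong A^Q≈A 1^Q≈1)
      -- Multiplying by `p̄ * p̄` completes `p̄` to a cube on one side and `p ^ q` to a cube on the
      -- other.
      [A+1]p̄³b≈ : (A + 1#) * p̄ ^ 3 * b ≈ δ * (p ^ q * (p ^ Q * p ^ Q))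
      [A+1]p̄³b≈ = begin
        (A + 1#) * p̄ ^ 3 * b
          ≈⟨ solve 3 (λ a p̄ b → a :* p̄ :^ 3 :* b := b :* (a :* p̄) :* (p̄ :* p̄)) refl (A + 1#) p̄ b ⟩
        b * ((A + 1#) * p̄) * (p̄ * p̄)
          ≈⟨ *-cong δp^q≈b[A+1]p̄ (*-cong p^Q≈p̄ p^Q≈p̄) ⟨
        δ * p ^ q * (p ^ Q * p ^ Q)
          ≈⟨ *-assoc δ (p ^ q) _ ⟩
        δ * (p ^ q * (p ^ Q * p ^ Q)) ∎

    p≈0 : p ≈ 0#
    p≈0 with δ ≟ 0#
    ... | yes δ≈0 = δ≈0⇒p≈0 δ≈0
    ... | no  δ≉0 = δ≉0⇒p≈0 δ≉0

    -- p ≈ 0 leaves δ T ≈ 0 and T̄ ≈ b T, so T ≉ 0 would force A ≈ N(b) ≈ 1.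
    T≈0 : T ≈ 0#
    T≈0 with T ≟ 0#
    ... | yes T≈0 = T≈0
    ... | no  T≉0 = ⊥-elim (¬[A≈1×N≈1] (trans (sym N≈A) N≈1) N≈1)
      where
      p̄≈0 : p̄ ≈ 0#
      p̄≈0 = trans (sym p^Q≈p̄) (x≈0⇒x^2^k≈0 h p≈0)
      δT≈0 : δ * T ≈ 0#
      δT≈0 = begin
        δ * T            ≈⟨ δT≈Ap̄+b̄p ⟩
        A * p̄ + b̄ * p    ≈⟨ +-cong (*-congˡ p̄≈0) (*-congˡ p≈0) ⟩
        A * 0# + b̄ * 0#  ≈⟨ solve 2 (λ a b → a :* con false :+ b :* con false := con false) refl A b̄ ⟩
        0#               ∎
      N≈A : b * b̄ ≈ A
      N≈A = x+y≈0⇒x≈y (xy≈0⇒y≈0 T≉0 (trans (*-comm T δ) δT≈0))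
      bT≈T̄ : b * T ≈ T̄
      bT≈T̄ = x+y≈0⇒x≈y (trans (sym p^q+p≈bT+T̄) (trans (+-cong (x≈0⇒x^2^k≈0 k p≈0) p≈0) (+-identityˡ 0#)))
      b̄T̄≈T : b̄ * T̄ ≈ T
      b̄T̄≈T = begin
        b̄ * T̄           ≈⟨ *-congˡ (trans (^-congˡ Q (sym T̄^Q≈T)) ([x^Q]^Q≈x T̄)) ⟨
        b̄ * T ^ Q       ≈⟨ ^-distrib-* b T Q ⟨
        (b * T) ^ Q     ≈⟨ ^-congˡ Q bT≈T̄ ⟩
        T̄ ^ Q           ≈⟨ T̄^Q≈T ⟩
        T               ∎
      N≈1 : b * b̄ ≈ 1#
      N≈1 = *-cancelˡ T≉0 (begin
        T * (b * b̄)     ≈⟨ solve 3 (λ T b b̄ → T :* (b :* b̄) := b̄ :* (b :* T)) refl T b b̄ ⟩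
        b̄ * (b * T)     ≈⟨ *-congˡ bT≈T̄ ⟩
        b̄ * T̄           ≈⟨ b̄T̄≈T ⟩
        T               ≈⟨ *-identityʳ T ⟨
        T * 1#          ∎)

    trivial : (s ≈ 0# × t ≈ 0#) ⊎ (s ≈ 1# × t ≈ 1#)
    trivial = Sum.map
      (λ t≈0 → trans (x+y≈0⇒x≈y p≈0) (x≈0⇒x^2^k≈0 h t≈0) , t≈0)
      (λ t≈1 → trans (x+y≈0⇒x≈y p≈0) (trans (^-congˡ Q t≈1) 1^Q≈1) , t≈1)
      (x^q≈x⇒x≈0⊎x≈1 (x+y≈0⇒x≈y T≈0))

  -- The kernel of the linearised Gold power `x ^ (q + 1)`: division by `u ^ q * u` turns the
  -- equation into `s ^ q + s ≈ 0#`.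
  x^q*u+u^q*x≈0⇒x≈0⊎x≈u : ∀ {x u} → u ≉0 → x ^ q * u + u ^ q * x ≈ 0# → x ≈ 0# ⊎ x ≈ u
  x^q*u+u^q*x≈0⇒x≈0⊎x≈u {x} {u} u≉0 eq = Sum.map
    (λ s≈0 → trans (sym (x/y*y≈x u≉0)) (trans (*-congʳ s≈0) (zeroˡ u)))
    (λ s≈1 → trans (sym (x/y*y≈x u≉0)) (trans (*-congʳ s≈1) (*-identityˡ u)))
    (x^q≈x⇒x≈0⊎x≈1 s^q≈s)
    where
    s = x / u ⟨ u≉0 ⟩
    s^q≈s : s ^ q ≈ s
    s^q≈s = x+y≈0⇒x≈y (xy≈0⇒y≈0 (*-≉0 (^-≉0 q u≉0) u≉0) (begin
      u ^ q * u * (s ^ q + s)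
        ≈⟨ solve 4 (λ uq u sq s → uq :* u :* (sq :+ s) := sq :* uq :* u :+ uq :* (s :* u)) refl (u ^ q) u (s ^ q) s ⟩
      s ^ q * u ^ q * u + u ^ q * (s * u)
        ≈⟨ +-cong (*-congʳ (trans (sym (^-distrib-* s u q)) (^-congˡ q (x/y*y≈x u≉0)))) (*-congˡ (x/y*y≈x u≉0)) ⟩
      x ^ q * u + u ^ q * x
        ≈⟨ eq ⟩
      0# ∎))

  -- Reduction of the linearised system to the normalised one.

  module Derivative {B a e} (B-nonCube : ¬ IsCube B) (a≉0 : a ≉0) (a^Q≈a : a ^ Q ≈ a)
    (nondegenerate : ¬ B ^ (q ℕ.+ r) ≈ a ^ (q ℕ.+ 1)) (Be≈a : B * e ≈ a) where

    a-IsCube : IsCube a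
    a-IsCube = x^Q≈x⇒IsCube j Q≡ a≉0 a^Q≈a

    twisted-proportional⇒y≈0 : ∀ {u y} → u ≉0 → B * (u ^ r * y) ≈ a * (u * y ^ r) → y ≈ 0#
    twisted-proportional⇒y≈0 {y = y} u≉0 eq with y ≟ 0#
    ... | yes y≈0 = y≈0
    ... | no  y≉0 = ⊥-elim (B-nonCube
      (twisted-proportional⇒IsCube l r≡ a-IsCube u≉0 y≉0 eq))

    B≉0 : B ≉0
    B≉0 B≈0 = B-nonCube (0# , trans (zeroˡ _) (sym B≈0))

    -- The second equation loses its terms in `y` and forces `x` to vanish; the first is then the
    -- Gold equation in `y` and `v`.
    kernel-at-u≈0 : ∀ {u v x y} → u ≈ 0# → v ≉0 →
      (x ^ q * u + u ^ q * x) + B * (y ^ q * v + v ^ q * y) ≈ 0# →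
      B * (x ^ r * v + u ^ r * y) + a * (x * v ^ r + u * y ^ r) ≈ 0# →
      (x ≈ 0# × y ≈ 0#) ⊎ (x ≈ u × y ≈ v)
    kernel-at-u≈0 {u} {v} {x} {y} u≈0 v≉0 eq₁ eq₂ = Sum.map
      (λ y≈0 → x≈0 , y≈0)
      (λ y≈v → trans x≈0 (sym u≈0) , y≈v)
      (x^q*u+u^q*x≈0⇒x≈0⊎x≈u v≉0 (xy≈0⇒y≈0 B≉0 (begin
        B * w
          ≈⟨ solve 3 (λ xq x w → w := xq :* con false :+ con false :* x :+ w) refl (x ^ q) x (B * w) ⟩
        x ^ q * 0# + 0# * x + B * w
          ≈⟨ +-congʳ (+-cong (*-congˡ u≈0) (*-congʳ (x≈0⇒x^2^k≈0 k u≈0))) ⟨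
        x ^ q * u + u ^ q * x + B * w
          ≈⟨ eq₁ ⟩
        0# ∎)))
      where
      w = y ^ q * v + v ^ q * y
      Bx^rv≈axv^r : B * (x ^ r * v) ≈ a * (x * v ^ r)
      Bx^rv≈axv^r = x+y≈0⇒x≈y (begin
        B * (x ^ r * v) + a * (x * v ^ r)
          ≈⟨ solve 6 (λ B w a z y yr →
               B :* w :+ a :* z := B :* (w :+ con false :* y) :+ a :* (z :+ con false :* yr))
               refl B (x ^ r * v) a (x * v ^ r) y (y ^ r) ⟩
        B * (x ^ r * v + 0# * y) + a * (x * v ^ r + 0# * y ^ r)
          ≈⟨ +-cong (*-congˡ (+-congˡ (*-congʳ (x≈0⇒x^r≈0 u≈0)))) (*-congˡ (+-congˡ (*-congʳ u≈0))) ⟨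
        B * (x ^ r * v + u ^ r * y) + a * (x * v ^ r + u * y ^ r)
          ≈⟨ eq₂ ⟩
        0# ∎)
      x≈0 : x ≈ 0#
      x≈0 with x ≟ 0#
      ... | yes x≈0 = x≈0
      -- The lemma is applied with `x` in the role of `u` and `v` in that of `y`.
      ... | no  x≉0 = contradiction (twisted-proportional⇒y≈0 x≉0 Bx^rv≈axv^r) v≉0

    -- Now the second equation forces `y` to vanish, and the first is the Gold equation in `x` and
    -- `u`.
    kernel-at-v≈0 : ∀ {u v x y} → u ≉0 → v ≈ 0# →
      (x ^ q * u + u ^ q * x) + B * (y ^ q * v + v ^ q * y) ≈ 0# →
      B * (x ^ r * v + u ^ r * y) + a * (x * v ^ r + u * y ^ r) ≈ 0# →
      (x ≈ 0# × y ≈ 0#) ⊎ (x ≈ u × y ≈ v)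
    kernel-at-v≈0 {u} {v} {x} {y} u≉0 v≈0 eq₁ eq₂ = Sum.map
      (λ x≈0 → x≈0 , y≈0)
      (λ x≈u → x≈u , trans y≈0 (sym v≈0))
      (x^q*u+u^q*x≈0⇒x≈0⊎x≈u u≉0 (begin
        w
          ≈⟨ solve 4 (λ w B y yq → w := w :+ B :* (yq :* con false :+ con false :* y)) refl w B y (y ^ q) ⟩
        w + B * (y ^ q * 0# + 0# * y)
          ≈⟨ +-congˡ (*-congˡ (+-cong (*-congˡ v≈0) (*-congʳ (x≈0⇒x^2^k≈0 k v≈0)))) ⟨
        w + B * (y ^ q * v + v ^ q * y)
          ≈⟨ eq₁ ⟩
        0# ∎))
      where
      w = x ^ q * u + u ^ q * x
      Bu^ry≈auy^r : B * (u ^ r * y) ≈ a * (u * y ^ r)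
      Bu^ry≈auy^r = x+y≈0⇒x≈y (begin
        B * (u ^ r * y) + a * (u * y ^ r)
          ≈⟨ solve 6 (λ B w a z x xr →
               B :* w :+ a :* z := B :* (xr :* con false :+ w) :+ a :* (x :* con false :+ z))
               refl B (u ^ r * y) a (u * y ^ r) x (x ^ r) ⟩
        B * (x ^ r * 0# + u ^ r * y) + a * (x * 0# + u * y ^ r)
          ≈⟨ +-cong (*-congˡ (+-congʳ (*-congˡ v≈0))) (*-congˡ (+-congʳ (*-congˡ (x≈0⇒x^r≈0 v≈0)))) ⟨
        B * (x ^ r * v + u ^ r * y) + a * (x * v ^ r + u * y ^ r)
          ≈⟨ eq₂ ⟩
        0# ∎)
      y≈0 : y ≈ 0#
      y≈0 = twisted-proportional⇒y≈0 u≉0 Bu^ry≈auy^r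

    kernel-at-u,v≉0 : ∀ {u v x y} → u ≉0 → v ≉0 →
      (x ^ q * u + u ^ q * x) + B * (y ^ q * v + v ^ q * y) ≈ 0# →
      B * (x ^ r * v + u ^ r * y) + a * (x * v ^ r + u * y ^ r) ≈ 0# →
      (x ≈ 0# × y ≈ 0#) ⊎ (x ≈ u × y ≈ v)
    kernel-at-u,v≉0 {u} {v} {x} {y} u≉0 v≉0 eq₁ eq₂ = Sum.map
      (λ (s≈0 , t≈0) → trans x≈su (trans (*-congʳ s≈0) (zeroˡ u))
                     , trans y≈tv (trans (*-congʳ t≈0) (zeroˡ v)))
      (λ (s≈1 , t≈1) → trans x≈su (trans (*-congʳ s≈1) (*-identityˡ u))
                     , trans y≈tv (trans (*-congʳ t≈1) (*-identityˡ v)))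
      trivial
      where
      s = x / u ⟨ u≉0 ⟩
      t = y / v ⟨ v≉0 ⟩
      w = v / u ⟨ u≉0 ⟩
      b = B * (w ^ q * w)
      -- Division by `u ^ r * u` alone would give the second equation the coefficients `B * w` and
      -- `a * w ^ r`. A further factor `w ^ q` turns the first into `b` and makes the second
      -- invariant under conjugation, which swaps `w ^ q` and `w ^ r`.
      A = a * (w ^ q * w ^ r)

      x≈su = sym (x/y*y≈x {x} u≉0)
      y≈tv = sym (x/y*y≈x {y} v≉0)
      v≈wu = sym (x/y*y≈x {v} u≉0)

      ^-factor : ∀ n {x y z} → x ≈ y * z → x ^ n ≈ y ^ n * z ^ n
      ^-factor n {x} {y} {z} x≈yz = trans (^-congˡ n x≈yz) (^-distrib-* y z n)

      w≉0 : w ≉0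
      w≉0 w≈0 = v≉0 (trans v≈wu (trans (*-congʳ w≈0) (zeroˡ u)))

      w^q≉0 : (w ^ q) ≉0
      w^q≉0 = ^-≉0 q w≉0

      w^r≉0 : (w ^ r) ≉0
      w^r≉0 = ^-≉0 r w≉0

      -- `q + 1` is divisible by 3, so `b` and `B` have the same class modulo cubes.
      w^q*w-IsCube : IsCube (w ^ q * w)
      w^q*w-IsCube = IsCube-resp (*-comm w (w ^ q))
        (IsCube-^ w (1 ℕ.+ i) (≡.cong suc q≡))

      b-nonCube : ¬ IsCube b
      b-nonCube b-cube = B-nonCube (IsCube-cancelˡ (*-≉0 w^q≉0 w≉0) w^q*w-IsCube
        (IsCube-resp (*-comm B (w ^ q * w)) b-cube))

      A≉0 : A ≉0
      A≉0 = *-≉0 a≉0 (*-≉0 w^q≉0 w^r≉0)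

      A^Q≈A : A ^ Q ≈ A
      A^Q≈A = begin
        A ^ Q                              ≈⟨ ^-distrib-* a _ Q ⟩
        a ^ Q * (w ^ q * w ^ r) ^ Q        ≈⟨ *-cong a^Q≈a (^-distrib-* (w ^ q) (w ^ r) Q) ⟩
        a * ((w ^ q) ^ Q * (w ^ r) ^ Q)    ≈⟨ *-congˡ (*-cong ([x^q]^Q≈x^r w) ([x^r]^Q≈x^q w)) ⟩
        a * (w ^ r * w ^ q)                ≈⟨ *-congˡ (*-comm (w ^ r) (w ^ q)) ⟩
        A                                  ∎

      -- Passing from `B` and `a` to `b` and `A` multiplies both sides by the same power of `w`,
      -- with exponent (q + r)(q + 1).
      b-A-nondegenerate : ¬ b ^ (q ℕ.+ r) ≈ A ^ (q ℕ.+ 1)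
      b-A-nondegenerate b^≈A^ = nondegenerate (*-cancelˡ (^-≉0 (q ℕ.+ 1) (*-≉0 w^q≉0 w^r≉0)) (begin
        (w ^ q * w ^ r) ^ (q ℕ.+ 1) * B ^ (q ℕ.+ r)   ≈⟨ *-comm _ _ ⟩
        B ^ (q ℕ.+ r) * (w ^ q * w ^ r) ^ (q ℕ.+ 1)   ≈⟨ *-congˡ norms ⟩
        B ^ (q ℕ.+ r) * (w ^ q * w) ^ (q ℕ.+ r)       ≈⟨ ^-distrib-* B (w ^ q * w) (q ℕ.+ r) ⟨
        b ^ (q ℕ.+ r)                                 ≈⟨ b^≈A^ ⟩
        A ^ (q ℕ.+ 1)                                 ≈⟨ ^-distrib-* a (w ^ q * w ^ r) (q ℕ.+ 1) ⟩
        a ^ (q ℕ.+ 1) * (w ^ q * w ^ r) ^ (q ℕ.+ 1)   ≈⟨ *-comm _ _ ⟩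
        (w ^ q * w ^ r) ^ (q ℕ.+ 1) * a ^ (q ℕ.+ 1)   ∎))
        where
        norms : (w ^ q * w ^ r) ^ (q ℕ.+ 1) ≈ (w ^ q * w) ^ (q ℕ.+ r)
        norms = begin
          (w ^ q * w ^ r) ^ (q ℕ.+ 1)      ≈⟨ ^-congˡ (q ℕ.+ 1) (^-homo-* w q r) ⟨
          (w ^ (q ℕ.+ r)) ^ (q ℕ.+ 1)      ≈⟨ ^-comm w (q ℕ.+ r) (q ℕ.+ 1) ⟩
          (w ^ (q ℕ.+ 1)) ^ (q ℕ.+ r)      ≈⟨ ^-congˡ (q ℕ.+ r) (x^[n+1]≈x^n*x w q) ⟩
          (w ^ q * w) ^ (q ℕ.+ r)          ∎

      normalised₁ : s ^ q + s ≈ b * (t ^ q + t)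
      normalised₁ = x+y≈0⇒x≈y (xy≈0⇒y≈0 (*-≉0 (^-≉0 q u≉0) u≉0) (begin
        uq * u * (s ^ q + s + b * (t ^ q + t))
          ≈⟨ distribˡ (uq * u) (s ^ q + s) _ ⟩
        uq * u * (s ^ q + s) + uq * u * (b * (t ^ q + t))
          ≈⟨ +-cong
               (solve 4 (λ uq u sq s → uq :* u :* (sq :+ s) := sq :* uq :* u :+ uq :* (s :* u))
                  refl uq u (s ^ q) s)
               (solve 7 (λ uq u B wq w tq t →
                  uq :* u :* (B :* (wq :* w) :* (tq :+ t)) :=
                  B :* (tq :* (wq :* uq) :* (w :* u) :+ wq :* uq :* (t :* (w :* u))))
                  refl uq u B (w ^ q) w (t ^ q) t) ⟩
        s ^ q * uq * u + uq * (s * u) +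
        B * (t ^ q * (w ^ q * uq) * (w * u) + w ^ q * uq * (t * (w * u)))
          ≈⟨ +-congˡ (*-congˡ (+-cong
               (*-cong (*-congˡ (^-factor q v≈wu)) v≈wu)
               (*-cong (^-factor q v≈wu) (*-congˡ v≈wu)))) ⟨
        s ^ q * uq * u + uq * (s * u) + B * (t ^ q * v ^ q * v + v ^ q * (t * v))
          ≈⟨ +-cong (+-cong (*-congʳ (^-factor q x≈su)) (*-congˡ x≈su))
                    (*-congˡ (+-cong (*-congʳ (^-factor q y≈tv)) (*-congˡ y≈tv))) ⟨
        x ^ q * u + uq * x + B * (y ^ q * v + v ^ q * y)
          ≈⟨ eq₁ ⟩
        0# ∎))
        where uq = u ^ q

      normalised₂ : b * (s ^ r + t) ≈ A * (s + t ^ r)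
      normalised₂ = x+y≈0⇒x≈y (xy≈0⇒y≈0 (*-≉0 (^-≉0 r u≉0) u≉0) (begin
        ur * u * (b * (s ^ r + t) + A * (s + t ^ r))
          ≈⟨ distribˡ (ur * u) (b * (s ^ r + t)) _ ⟩
        ur * u * (b * (s ^ r + t)) + ur * u * (A * (s + t ^ r))
          ≈⟨ +-cong
               (solve 7 (λ ur u B wq w sr t →
                  ur :* u :* (B :* (wq :* w) :* (sr :+ t)) :=
                  wq :* (B :* (sr :* ur :* (w :* u) :+ ur :* (t :* (w :* u)))))
                  refl ur u B (w ^ q) w (s ^ r) t)
               (solve 7 (λ ur u a wq wr s tr →
                  ur :* u :* (a :* (wq :* wr) :* (s :+ tr)) :=
                  wq :* (a :* (s :* u :* (wr :* ur) :+ u :* (tr :* (wr :* ur)))))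
                  refl ur u a (w ^ q) (w ^ r) s (t ^ r)) ⟩
        w ^ q * (B * (s ^ r * ur * (w * u) + ur * (t * (w * u)))) +
        w ^ q * (a * (s * u * (w ^ r * ur) + u * (t ^ r * (w ^ r * ur))))
          ≈⟨ distribˡ (w ^ q) _ _ ⟨
        w ^ q * (B * (s ^ r * ur * (w * u) + ur * (t * (w * u))) +
                 a * (s * u * (w ^ r * ur) + u * (t ^ r * (w ^ r * ur))))
          ≈⟨ *-congˡ (+-cong
               (*-congˡ (+-cong (*-congˡ v≈wu) (*-congˡ (*-congˡ v≈wu))))
               (*-congˡ (+-cong (*-congˡ (^-factor r v≈wu)) (*-congˡ (*-congˡ (^-factor r v≈wu)))))) ⟨
        w ^ q * (B * (s ^ r * ur * v + ur * (t * v)) + a * (s * u * v ^ r + u * (t ^ r * v ^ r)))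
          ≈⟨ *-congˡ (+-cong
               (*-congˡ (+-cong (*-congʳ (^-factor r x≈su)) (*-congˡ y≈tv)))
               (*-congˡ (+-cong (*-congʳ x≈su) (*-congˡ (^-factor r y≈tv))))) ⟨
        w ^ q * (B * (x ^ r * v + ur * y) + a * (x * v ^ r + u * y ^ r))
          ≈⟨ *-congˡ eq₂ ⟩
        w ^ q * 0#
          ≈⟨ zeroʳ (w ^ q) ⟩
        0# ∎))
        where ur = u ^ r

      open Normalised b-nonCube A≉0 A^Q≈A b-A-nondegenerate normalised₁ normalised₂ using (trivial)

    -- Clears the denominator of `e`, which stands for `a / B`.
    scale-by-B : ∀ {w z} → w + e * z ≈ 0# → B * w + a * z ≈ 0#
    scale-by-B {w} {z} eq = begin
      B * w + a * z        ≈⟨ +-congˡ (*-congʳ Be≈a) ⟨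
      B * w + B * e * z    ≈⟨ solve 4 (λ B w e z → B :* w :+ B :* e :* z := B :* (w :+ e :* z)) refl B w e z ⟩
      B * (w + e * z)      ≈⟨ *-congˡ eq ⟩
      B * 0#               ≈⟨ zeroʳ B ⟩
      0#                   ∎

    kernel : ∀ {u v x y} → ¬ (u ≈ 0# × v ≈ 0#) →
      (x ^ q * u + u ^ q * x) + B * (y ^ q * v + v ^ q * y) ≈ 0# →
      (x ^ r * v + u ^ r * y) + e * (x * v ^ r + u * y ^ r) ≈ 0# →
      (x ≈ 0# × y ≈ 0#) ⊎ (x ≈ u × y ≈ v)
    kernel {u} {v} {x} {y} uv≉0 eq₁ eq₂ with u ≟ 0# | v ≟ 0#
    ... | yes u≈0 | yes v≈0 = contradiction (u≈0 , v≈0) uv≉0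
    ... | yes u≈0 | no  v≉0 = kernel-at-u≈0 u≈0 v≉0 eq₁ (scale-by-B eq₂)
    ... | no  u≉0 | yes v≈0 = kernel-at-v≈0 u≉0 v≈0 eq₁ (scale-by-B eq₂)
    ... | no  u≉0 | no  v≉0 = kernel-at-u,v≉0 u≉0 v≉0 eq₁ (scale-by-B eq₂)

    -- Linearisation of the derivative of F.

    F₁ F₂ : Carrier → Carrier → Carrier
    F₁ x y = x ^ (q ℕ.+ 1) + B * y ^ (q ℕ.+ 1)
    F₂ x y = x ^ r * y + e * (x * y ^ r)

    -- `x ^ (q + 1)` is the product of the additive maps `x ^ q` and `x`, so `polarisation` applies
    -- to each term.
    ∂F₁ : ∀ x y x′ y′ u v →
      (F₁ x y + F₁ (x + u) (y + v)) + (F₁ x′ y′ + F₁ (x′ + u) (y′ + v)) ≈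
      ((x + x′) ^ q * u + u ^ q * (x + x′)) + B * ((y + y′) ^ q * v + v ^ q * (y + y′))
    ∂F₁ x y x′ y′ u v = begin
      (F₁ x y + F₁ (x + u) (y + v)) + (F₁ x′ y′ + F₁ (x′ + u) (y′ + v))
        ≈⟨ regroup B (P x) (P (x + u)) (P x′) (P (x′ + u)) (P y) (P (y + v)) (P y′) (P (y′ + v)) ⟩
      ∂P x x′ u + B * ∂P y y′ v
        ≈⟨ +-cong (∂P≈ x x′ u) (*-congˡ (∂P≈ y y′ v)) ⟩
      ((x + x′) ^ q * u + u ^ q * (x + x′)) + B * ((y + y′) ^ q * v + v ^ q * (y + y′)) ∎
      where
      P : Carrier → Carrier
      P x = x ^ (q ℕ.+ 1)
      ∂P : Carrier → Carrier → Carrier → Carrier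
      ∂P x x′ u = (P x + P (x + u)) + (P x′ + P (x′ + u))
      P[x+u]≈ : ∀ x u → P (x + u) ≈ (x ^ q + u ^ q) * (x + u)
      P[x+u]≈ x u = trans (x^[n+1]≈x^n*x (x + u) q) (*-congʳ (^q-+ x u))
      ∂P≈ : ∀ x x′ u → ∂P x x′ u ≈ (x + x′) ^ q * u + u ^ q * (x + x′)
      ∂P≈ x x′ u = begin
        ∂P x x′ u
          ≈⟨ +-cong (+-cong (x^[n+1]≈x^n*x x q) (P[x+u]≈ x u)) (+-cong (x^[n+1]≈x^n*x x′ q) (P[x+u]≈ x′ u)) ⟩
        (x ^ q * x + (x ^ q + u ^ q) * (x + u)) + (x′ ^ q * x′ + (x′ ^ q + u ^ q) * (x′ + u))
          ≈⟨ polarisation (x ^ q) x (x′ ^ q) x′ (u ^ q) u ⟩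
        (x ^ q + x′ ^ q) * u + u ^ q * (x + x′)
          ≈⟨ +-congʳ (*-congʳ (^q-+ x x′)) ⟨
        (x + x′) ^ q * u + u ^ q * (x + x′) ∎

    -- Each term is again a product of two additive maps, now in different variables.
    ∂F₂ : ∀ x y x′ y′ u v →
      (F₂ x y + F₂ (x + u) (y + v)) + (F₂ x′ y′ + F₂ (x′ + u) (y′ + v)) ≈
      ((x + x′) ^ r * v + u ^ r * (y + y′)) + e * ((x + x′) * v ^ r + u * (y + y′) ^ r)
    ∂F₂ x y x′ y′ u v = begin
      (F₂ x y + F₂ (x + u) (y + v)) + (F₂ x′ y′ + F₂ (x′ + u) (y′ + v))
        ≈⟨ regroup e (x ^ r * y) ((x + u) ^ r * (y + v)) (x′ ^ r * y′) ((x′ + u) ^ r * (y′ + v))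
                     (x * y ^ r) ((x + u) * (y + v) ^ r) (x′ * y′ ^ r) ((x′ + u) * (y′ + v) ^ r) ⟩
      ((x ^ r * y + (x + u) ^ r * (y + v)) + (x′ ^ r * y′ + (x′ + u) ^ r * (y′ + v))) +
      e * ((x * y ^ r + (x + u) * (y + v) ^ r) + (x′ * y′ ^ r + (x′ + u) * (y′ + v) ^ r))
        ≈⟨ +-cong (∂[x^ry]≈) (*-congˡ ∂[xy^r]≈) ⟩
      ((x + x′) ^ r * v + u ^ r * (y + y′)) + e * ((x + x′) * v ^ r + u * (y + y′) ^ r) ∎
      where
      ∂[x^ry]≈ :
        (x ^ r * y + (x + u) ^ r * (y + v)) + (x′ ^ r * y′ + (x′ + u) ^ r * (y′ + v)) ≈
        (x + x′) ^ r * v + u ^ r * (y + y′)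
      ∂[x^ry]≈ = begin
        (x ^ r * y + (x + u) ^ r * (y + v)) + (x′ ^ r * y′ + (x′ + u) ^ r * (y′ + v))
          ≈⟨ +-cong (+-congˡ (*-congʳ (^r-+ x u))) (+-congˡ (*-congʳ (^r-+ x′ u))) ⟩
        (x ^ r * y + (x ^ r + u ^ r) * (y + v)) + (x′ ^ r * y′ + (x′ ^ r + u ^ r) * (y′ + v))
          ≈⟨ polarisation (x ^ r) y (x′ ^ r) y′ (u ^ r) v ⟩
        (x ^ r + x′ ^ r) * v + u ^ r * (y + y′)
          ≈⟨ +-congʳ (*-congʳ (^r-+ x x′)) ⟨
        (x + x′) ^ r * v + u ^ r * (y + y′) ∎
      ∂[xy^r]≈ :
        (x * y ^ r + (x + u) * (y + v) ^ r) + (x′ * y′ ^ r + (x′ + u) * (y′ + v) ^ r) ≈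
        (x + x′) * v ^ r + u * (y + y′) ^ r
      ∂[xy^r]≈ = begin
        (x * y ^ r + (x + u) * (y + v) ^ r) + (x′ * y′ ^ r + (x′ + u) * (y′ + v) ^ r)
          ≈⟨ +-cong (+-congˡ (*-congˡ (^r-+ y v))) (+-congˡ (*-congˡ (^r-+ y′ v))) ⟩
        (x * y ^ r + (x + u) * (y ^ r + v ^ r)) + (x′ * y′ ^ r + (x′ + u) * (y′ ^ r + v ^ r))
          ≈⟨ polarisation x (y ^ r) x′ (y′ ^ r) u (v ^ r) ⟩
        (x + x′) * v ^ r + u * (y ^ r + y′ ^ r)
          ≈⟨ +-congˡ (*-congˡ (^r-+ y y′)) ⟨
        (x + x′) * v ^ r + u * (y + y′) ^ r ∎

    -- Two points with equal derivatives differ by an element of the kernel, that is by 0 or by the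
    -- direction `(u , v)`.
    unique-pair : ∀ {u v} → ¬ (u ≈ 0# × v ≈ 0#) → ∀ {x y x′ y′} →
      F₁ x y + F₁ (x + u) (y + v) ≈ F₁ x′ y′ + F₁ (x′ + u) (y′ + v) →
      F₂ x y + F₂ (x + u) (y + v) ≈ F₂ x′ y′ + F₂ (x′ + u) (y′ + v) →
      (x′ ≈ x × y′ ≈ y) ⊎ (x′ ≈ x + u × y′ ≈ y + v)
    unique-pair {u} {v} uv≉0 {x} {y} {x′} {y′} eq₁ eq₂ = Sum.map
      (λ (x+x′≈0 , y+y′≈0) → sym (x+y≈0⇒x≈y x+x′≈0) , sym (x+y≈0⇒x≈y y+y′≈0))
      (λ (x+x′≈u , y+y′≈v) → shift x+x′≈u , shift y+y′≈v)
      (kernel uv≉0 (trans (sym (∂F₁ x y x′ y′ u v)) (x≈y⇒x+y≈0 eq₁))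
                   (trans (sym (∂F₂ x y x′ y′ u v)) (x≈y⇒x+y≈0 eq₂)))
      where
      shift : ∀ {x x′ u} → x + x′ ≈ u → x′ ≈ x + u
      shift {x} {x′} x+x′≈u = trans (solve 2 (λ x x′ → x′ := x :+ (x :+ x′)) refl x x′) (+-congˡ x+x′≈u)

-- Residues of the exponents.

-- Each step multiplies by 4, which is 1 modulo 3.
2^[2l+1]≡2[3] : ∀ l → ∃[ i ] 2 ℕ.^ (1 ℕ.+ l ℕ.* 2) ≡ 2 ℕ.+ i ℕ.* 3
2^[2l+1]≡2[3] zero    = 0 , ≡.refl
2^[2l+1]≡2[3] (suc l) with i , eq ← 2^[2l+1]≡2[3] l =
  2 ℕ.+ i ℕ.* 4 , ≡.trans (≡.cong (λ n → 2 ℕ.* (2 ℕ.* n)) eq) (expand i)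
  where
  expand : ∀ i → 2 ℕ.* (2 ℕ.* (2 ℕ.+ i ℕ.* 3)) ≡ 2 ℕ.+ (2 ℕ.+ i ℕ.* 4) ℕ.* 3
  expand = solve-∀

-- Were `k` even, 2 would divide the gcd.
coprime-to-even⇒odd : ∀ {k m} l → m ≡ l ℕ.* 2 → gcd k m ≡ 1 → ∃[ i ] k ≡ 1 ℕ.+ i ℕ.* 2
coprime-to-even⇒odd {k} {m} l m≡2l gcd≡1 with k ℕ.% 2 in k%2≡ | m≡m%n+[m/n]*n k 2 | m%n<n k 2
... | 0 | k≡ | _ = contradiction (∣1⇒≡1 (≡.subst (2 ∣_) gcd≡1 (gcd-greatest (divides (k ℕ./ 2) k≡) (divides l m≡2l)))) λ ()
... | 1 | k≡ | _ = k ℕ./ 2 , k≡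
... | suc (suc _) | _ | ℕ.s≤s (ℕ.s≤s ())

m%4≡2⇒m≡2[2l+1] : ∀ {m} → m ℕ.% 4 ≡ 2 → m ≡ (1 ℕ.+ (m ℕ./ 4) ℕ.* 2) ℕ.* 2
m%4≡2⇒m≡2[2l+1] {m} m%4≡2 = ≡.trans (m≡m%n+[m/n]*n m 4)
  (≡.trans (≡.cong (ℕ._+ (m ℕ./ 4) ℕ.* 4) m%4≡2) (expand (m ℕ./ 4)))
  where
  expand : ∀ l → 2 ℕ.+ l ℕ.* 4 ≡ (1 ℕ.+ l ℕ.* 2) ℕ.* 2
  expand = solve-∀

-- Specialisation to `m` congruent to 2 modulo 4 and to `a` in the subfield.

open import Data.Nat.Base using (_+_; _*_; _∸_; _^_; _≤_; _/_; _%_)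

theorem3p3 :
    ∀ {c ℓ c′ ℓ′} (m : ℕ) → m % 4 ≡ 2 →
    (𝕄 : Field c ℓ) → IsFiniteFieldOfOrder (2 ^ m) 𝕄 →
    let Q = 2 ^ (m / 2) in
    (𝕂 : Field c′ ℓ′) → IsFiniteFieldOfOrder Q 𝕂 →
    (ι : Field.Carrier 𝕂 → Field.Carrier 𝕄) → IsEmbedding 𝕂 𝕄 ι →
    (k : ℕ) → 1 ≤ k → k ≤ m ∸ 1 → gcd k m ≡ 1 →
    let q = 2 ^ k
        r = q * Q
        module K = Field 𝕂
        module M = Field 𝕄
    in
    (B : M.Carrier) (B≉0 : B M.≉0) → M.NonCube B →
    (a : K.Carrier) → a K.≉0 →
    ¬ ((B M.^ (q + r)) M.≈ (ι a M.^ (q + 1))) →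
    APN (𝕄 ²) (biprojective 𝕄 q r B B≉0 (ι a))
theorem3p3 m m%4≡2 𝕄 ∣𝕄∣≡2^m 𝕂 ∣𝕂∣≡Q ι ι-embedding k _ _ gcd≡1 B B≉0 B-nonCube a a≉0 nondegenerate =
  -- The plane is finite, which makes it decidable whether a given value of the derivative is
  -- attained.
  unique-pair⇒APN (𝕄 ²) (×-hasCardinality ∣𝕄∣≡2^m ∣𝕄∣≡2^m)
    (biprojective 𝕄 q r B B≉0 (ι a))
    (λ (x , y) → x+x≈0 x , x+x≈0 y)
    (λ (u , v) uv≉0 (x , y) (x′ , y′) (eq₁ , eq₂) → unique-pair uv≉0 eq₁ eq₂)
  where
  module K = Field 𝕂
  module M = Field 𝕄
  module ι = IsRingMonomorphism ι-embedding
  open FieldProperties 𝕄 using (IsCube; x/y*y≈x)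

  h = m / 2
  q = 2 ^ k
  Q = 2 ^ h
  r = q * Q
  l = m / 4

  m≡ : m ≡ (1 + l * 2) * 2
  m≡ = m%4≡2⇒m≡2[2l+1] m%4≡2

  h≡ : h ≡ 1 + l * 2
  h≡ = ≡.trans (≡.cong (_/ 2) m≡) (m*n/n≡m (1 + l * 2) 2)

  k-odd : ∃[ i ] k ≡ 1 + i * 2
  k-odd = coprime-to-even⇒odd (1 + l * 2) m≡ gcd≡1

  q≡2[3] : ∃[ i ] q ≡ 2 + i * 3
  q≡2[3] with i , k≡ ← k-odd with i′ , eq ← 2^[2l+1]≡2[3] i = i′ , ≡.trans (≡.cong (2 ^_) k≡) eq

  Q≡2[3] : ∃[ j ] Q ≡ 2 + j * 3
  Q≡2[3] with j , eq ← 2^[2l+1]≡2[3] l = j , ≡.trans (≡.cong (2 ^_) h≡) eq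

  h+h≡m : h + h ≡ m
  h+h≡m = ≡.trans (double h) (≡.trans (≡.cong (_* 2) h≡) (≡.sym m≡))
    where
    double : ∀ n → n + n ≡ n * 2
    double = solve-∀

  ι-^ : ∀ x n → ι (x K.^ n) M.≈ ι x M.^ n
  ι-^ x zero    = ι.1#-homo
  ι-^ x (suc n) = M.trans (ι.*-homo x (x K.^ n)) (M.*-congˡ (ι-^ x n))

  -- Fermat's identity in 𝕂, transported along `ι`.
  ιa^Q≈ιa : ι a M.^ Q M.≈ ι a
  ιa^Q≈ιa = M.trans (M.sym (ι-^ a Q)) (ι.⟦⟧-cong (FiniteField.x^n≈x 𝕂 ∣𝕂∣≡Q a))

  ιa≉0 : ι a M.≉0
  ιa≉0 ιa≈0 = a≉0 (ι.injective (M.trans ιa≈0 (M.sym ι.0#-homo)))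

  -- `NonCube` speaks of nonzero roots only, but a root of `B` is nonzero because `B` is.
  ¬IsCube-B : ¬ IsCube B
  ¬IsCube-B (y , y³≈B) = B-nonCube (y , (λ y≈0 → B≉0 (M.trans (M.sym y³≈B)
    (M.trans (M.*-congʳ y≈0) (M.zeroˡ _)))) , y³≈B)

  Be≈ιa : B M.* (ι a M./ B ⟨ B≉0 ⟩) M.≈ ι a
  Be≈ιa = M.trans (M.*-comm B _) (x/y*y≈x B≉0)

  open Kernel 𝕄 ∣𝕄∣≡2^m k h gcd≡1 h+h≡m (proj₁ q≡2[3]) (proj₁ Q≡2[3]) (proj₂ q≡2[3]) (proj₂ Q≡2[3])
    using (x+x≈0; module Derivative)
  open Derivative ¬IsCube-B ιa≉0 ιa^Q≈ιa nondegenerate Be≈ιa using (unique-pair)
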